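{- There is no algorithm for bin packing, based on rounding up items, which achieves an additive integrality gap of $o(\log n)$ for all instances with $s_1,\dots,s_n>1/4$. That is, there is no function $g:\mathbb N\to\mathbb R$ with $g(n)=o(\log n)$ such that for every $n$, all item sizes $1\ge s_1\ge\dots\ge s_n>\tfrac14$ and every feasible fractional solution $y\in[0,1]^{\mathcal P}$ of (LP), the algorithm outputs a tuple $(x,D)$ whose additive integrality gap is at most $g(n)$.
   Context: For item sizes $s=(s_1,\dots,s_n)\in[0,1]^n$, sorted so that $s_1\ge\dots\ge s_n$, let $\mathcal P=\{p\in\{0,1\}^n : s^Tp\le 1\}$ be the set of feasible patterns; a pattern $p$ is identified with the set of items $\{i:p_i=1\}$. The linear program (LP) is $$\min \sum_{p\in\mathcal P} x_p \quad\text{s.t.}\quad \sum_{p\in\mathcal P} p\, x_p \ge \mathbf 1,\qquad x_p\ge 0 \ \ \forall p\in\mathcal P,$$ where $\mathbf 1$ is an all-ones vector of suitable dimension; a feasible fractional solution is a vector $y$ satisfying these constraints. Write $[n]=\{1,\dots,n\}$ and $\mathrm{supp}(x)=\{p\in\mathcal P: x_p\ne0\}$. Covering: for $D\subseteq[n]$ (discarded items), a vector $x\in\mathbb Z_{\ge0}^{\mathcal P}$ covers $[n]\setminus D$ if there is a map $\sigma:[n]\setminus D\to[n]$ with $\sigma(i)\le i$ for all $i\in[n]\setminus D$ and $\sum_{p\in\mathcal P:\,i\in p}x_p\ge|\sigma^{ -1}(i)|$ for all $i\in[n]$. An algorithm is based on rounding up items if, for given item sizes $s_1,\dots,s_n$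 and a given fractional solution $y\in[0,1]^{\mathcal P}$ to (LP), it produces a tuple $(x,D)$ with $D\subseteq[n]$ such that (1) $x\in\mathbb Z_{\ge0}^{\mathcal P}$, (2) $\mathrm{supp}(x)\subseteq\mathrm{supp}(y)$, and (3) $x$ covers $[n]\setminus D$. No restriction on running time is imposed. The additive integrality gap of a tuple $(x,D)$ is $\mathbf 1^Tx+2\sum_{i\in D}s_i-\mathbf 1^Ty$. -}

module Defs where

open import Data.Nat.Base as ℕ using (ℕ; zero; suc)
import Data.Nat.Properties as ℕ
open import Data.Nat.Induction using (<-rec)
open import Data.Nat.Logarithm using (⌊log₂_⌋; ⌊log₂⌋-mono-≤; ⌊log₂⌊n/2⌋⌋≡⌊log₂n⌋∸1; ⌊log₂[2^n]⌋≡n)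
open import Data.Integer.Base as ℤ using (+_; +[1+_])
import Data.Integer.Properties as ℤ
open import Data.Rational.Base as ℚ using (ℚ; 0ℚ; 1ℚ; ½; mkℚ)
import Data.Rational.Properties as ℚ
import Data.Rational.Unnormalised.Base as ℚᵘ
import Data.Rational.Unnormalised.Properties as ℚᵘ
open import Data.Rational.Solver using (module +-*-Solver)
open import Data.Fin.Base as Fin using (Fin)
import Data.Fin.Properties as Fin
open import Data.Fin.Subset using (Subset; inside; outside; _∈_; _∉_)
open import Data.Fin.Subset.Properties using (_∈?_)
open import Data.List.Base as List using (List; []; _∷_; _++_; map; filter; foldr; length; allFin)
open import Data.Vec.Base as Vec using ([]; _∷_)
open import Data.Product.Base using (∃-syntax; Σ-syntax; _×_; _,_; proj₁; proj₂)
open import Data.Sum.Base using (_⊎_; inj₁; inj₂)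
open import Relation.Nullary using (¬_; ¬?; _×-dec_)
open import Relation.Unary using (Pred; _⊆_)
open import Relation.Binary.PropositionalEquality

Cauchy : (ℕ → ℚ) → Set
Cauchy s = ∀ ε → 0ℚ ℚ.< ε →
  ∃[ N ] (∀ m n → N ℕ.≤ m → N ℕ.≤ n → ℚ.∣ s m ℚ.- s n ∣ ℚ.≤ ε)

record ℝ : Set where
  constructor real
  field
    seq    : ℕ → ℚ
    cauchy : Cauchy seq

open ℝ public

infix 4 _≤_ _<_ _≃_ _≄_

_≤_ : ℝ → ℝ → Set
x ≤ y = ∀ ε → 0ℚ ℚ.< ε → ∃[ N ] (∀ n → N ℕ.≤ n → seq x n ℚ.≤ seq y n ℚ.+ ε)

_<_ : ℝ → ℝ → Set
x < y = ∃[ ε ] (0ℚ ℚ.< ε × ∃[ N ] (∀ n → N ℕ.≤ n → seq x n ℚ.+ ε ℚ.≤ seq y n))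

_≃_ : ℝ → ℝ → Set
x ≃ y = x ≤ y × y ≤ x

_≄_ : ℝ → ℝ → Set
x ≄ y = ¬ (x ≃ y)

private
  half-pos : ∀ {ε} → 0ℚ ℚ.< ε → 0ℚ ℚ.< ½ ℚ.* ε
  half-pos {ε} 0<ε =
    ℚ.positive⁻¹ (½ ℚ.* ε) {{ℚ.pos*pos⇒pos ½ ε {{ℚ.positive 0<ε}}}}

  halves : ∀ ε → ½ ℚ.* ε ℚ.+ ½ ℚ.* ε ≡ ε
  halves ε = trans (sym (ℚ.*-distribʳ-+ ε ½ ½)) (ℚ.*-identityˡ ε)

  ∣p-q∣≡∣q-p∣ : ∀ p q → ℚ.∣ p ℚ.- q ∣ ≡ ℚ.∣ q ℚ.- p ∣
  ∣p-q∣≡∣q-p∣ p q = trans (cong ℚ.∣_∣ (lemma p q)) (ℚ.∣-p∣≡∣p∣ (q ℚ.- p))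
    where
    open +-*-Solver
    lemma : ∀ p q → p ℚ.- q ≡ ℚ.- (q ℚ.- p)
    lemma = solve 2 (λ p q → p :- q := :- (q :- p)) refl

  ∣p∣≤∣q∣+∣p-q∣ : ∀ p q → ℚ.∣ p ∣ ℚ.≤ ℚ.∣ q ∣ ℚ.+ ℚ.∣ p ℚ.- q ∣
  ∣p∣≤∣q∣+∣p-q∣ p q = begin
    ℚ.∣ p ∣                        ≡⟨ cong ℚ.∣_∣ (lemma p q) ⟩
    ℚ.∣ q ℚ.+ (p ℚ.- q) ∣          ≤⟨ ℚ.∣p+q∣≤∣p∣+∣q∣ q (p ℚ.- q) ⟩
    ℚ.∣ q ∣ ℚ.+ ℚ.∣ p ℚ.- q ∣      ∎
    where
    open ℚ.≤-Reasoning
    open +-*-Solver using (solve; _:=_; _:+_; _:-_)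
    lemma : ∀ p q → p ≡ q ℚ.+ (p ℚ.- q)
    lemma = solve 2 (λ p q → p := q :+ (p :- q)) refl

  ≤+⇒-≤ : ∀ {p q r} → p ℚ.≤ q ℚ.+ r → p ℚ.- q ℚ.≤ r
  ≤+⇒-≤ {p} {q} {r} h = begin
    p ℚ.- q            ≤⟨ ℚ.+-monoˡ-≤ (ℚ.- q) h ⟩
    q ℚ.+ r ℚ.- q      ≡⟨ lemma q r ⟩
    r                  ∎
    where
    open ℚ.≤-Reasoning
    open +-*-Solver using (solve; _:=_; _:+_; _:-_)
    lemma : ∀ q r → q ℚ.+ r ℚ.- q ≡ r
    lemma = solve 2 (λ q r → q :+ r :- q := r) refl

  ∣-∣-bound : ∀ p q {r} → p ℚ.≤ q ℚ.+ r → q ℚ.≤ p ℚ.+ r → ℚ.∣ p ℚ.- q ∣ ℚ.≤ r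
  ∣-∣-bound p q {r} h₁ h₂ with ℚ.∣p∣≡p∨∣p∣≡-p (p ℚ.- q)
  ... | inj₁ e = subst (ℚ._≤ r) (sym e) (≤+⇒-≤ {p} {q} h₁)
  ... | inj₂ e = subst (ℚ._≤ r) (sym (trans e (lemma p q))) (≤+⇒-≤ {q} {p} h₂)
    where
    open +-*-Solver
    lemma : ∀ p q → ℚ.- (p ℚ.- q) ≡ q ℚ.- p
    lemma = solve 2 (λ p q → :- (p :- q) := q :- p) refl

  abstract
    const-cauchy : ∀ q → Cauchy (λ _ → q)
    const-cauchy q ε 0<ε = 0 , λ _ _ _ _ →
      subst (λ z → ℚ.∣ z ∣ ℚ.≤ ε) (sym (ℚ.+-inverseʳ q)) (ℚ.<⇒≤ 0<ε)

  abstract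
    +-cauchy : ∀ x y → Cauchy (λ k → seq x k ℚ.+ seq y k)
    +-cauchy x y ε 0<ε with cauchy x (½ ℚ.* ε) (half-pos 0<ε) | cauchy y (½ ℚ.* ε) (half-pos 0<ε)
    ... | N , f | M , g = N ℕ.⊔ M , λ m n m≥ n≥ →
      let a = seq x m ; b = seq y m ; c = seq x n ; d = seq y n in begin
        ℚ.∣ a ℚ.+ b ℚ.- (c ℚ.+ d) ∣
          ≡⟨ cong ℚ.∣_∣ (lemma a b c d) ⟩
        ℚ.∣ (a ℚ.- c) ℚ.+ (b ℚ.- d) ∣
          ≤⟨ ℚ.∣p+q∣≤∣p∣+∣q∣ (a ℚ.- c) (b ℚ.- d) ⟩
        ℚ.∣ a ℚ.- c ∣ ℚ.+ ℚ.∣ b ℚ.- d ∣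
          ≤⟨ ℚ.+-mono-≤ (f m n (ℕ.m⊔n≤o⇒m≤o N M m≥) (ℕ.m⊔n≤o⇒m≤o N M n≥))
                        (g m n (ℕ.m⊔n≤o⇒n≤o N M m≥) (ℕ.m⊔n≤o⇒n≤o N M n≥)) ⟩
        ½ ℚ.* ε ℚ.+ ½ ℚ.* ε
          ≡⟨ halves ε ⟩
        ε ∎
      where
      open ℚ.≤-Reasoning
      open +-*-Solver using (solve; _:=_; _:+_; _:-_)
      lemma : ∀ a b c d → a ℚ.+ b ℚ.- (c ℚ.+ d) ≡ (a ℚ.- c) ℚ.+ (b ℚ.- d)
      lemma = solve 4 (λ a b c d → a :+ b :- (c :+ d) := (a :- c) :+ (b :- d)) refl

  abstract
    neg-cauchy : ∀ x → Cauchy (λ k → ℚ.- seq x k)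
    neg-cauchy x ε 0<ε with cauchy x ε 0<ε
    ... | N , f = N , λ m n m≥ n≥ →
      subst (ℚ._≤ ε)
        (trans (∣p-q∣≡∣q-p∣ (seq x m) (seq x n)) (cong ℚ.∣_∣ (lemma (seq x m) (seq x n))))
        (f m n m≥ n≥)
      where
      open +-*-Solver
      lemma : ∀ a b → b ℚ.- a ≡ ℚ.- a ℚ.- (ℚ.- b)
      lemma = solve 2 (λ a b → b :- a := :- a :- (:- b)) refl

  abstract
    abs-cauchy : ∀ x → Cauchy (λ k → ℚ.∣ seq x k ∣)
    abs-cauchy x ε 0<ε with cauchy x ε 0<ε
    ... | N , f = N , λ m n m≥ n≥ →
      ∣-∣-bound ℚ.∣ seq x m ∣ ℚ.∣ seq x n ∣
        (ℚ.≤-trans (∣p∣≤∣q∣+∣p-q∣ (seq x m) (seq x n)) (ℚ.+-monoʳ-≤ ℚ.∣ seq x n ∣ (f m n m≥ n≥)))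
        (ℚ.≤-trans (∣p∣≤∣q∣+∣p-q∣ (seq x n) (seq x m)) (ℚ.+-monoʳ-≤ ℚ.∣ seq x m ∣ (f n m n≥ m≥)))

  bounded : ∀ x → ∃[ B ] ∃[ N ] (ℚ.Positive B × (∀ n → N ℕ.≤ n → ℚ.∣ seq x n ∣ ℚ.≤ B))
  bounded x with cauchy x 1ℚ (ℚ.positive⁻¹ 1ℚ)
  ... | N , f = ℚ.∣ seq x N ∣ ℚ.+ 1ℚ , N
              , ℚ.nonNeg+pos⇒pos ℚ.∣ seq x N ∣ {{ℚ.∣-∣-nonNeg (seq x N)}} 1ℚ
              , λ n n≥ → ℚ.≤-trans (∣p∣≤∣q∣+∣p-q∣ (seq x n) (seq x N))
                                   (ℚ.+-monoʳ-≤ ℚ.∣ seq x N ∣ (f n N n≥ ℕ.≤-refl))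

  *-mono-≤ : ∀ {p q r s} → 0ℚ ℚ.≤ p → 0ℚ ℚ.≤ s → p ℚ.≤ q → r ℚ.≤ s → p ℚ.* r ℚ.≤ q ℚ.* s
  *-mono-≤ {p} {q} {r} {s} 0≤p 0≤s p≤q r≤s = ℚ.≤-trans
    (ℚ.*-monoˡ-≤-nonNeg p {{ℚ.nonNegative 0≤p}} r≤s)
    (ℚ.*-monoʳ-≤-nonNeg s {{ℚ.nonNegative 0≤s}} p≤q)

  scaled : ∀ B → ℚ.Positive B → ∀ {ε} → 0ℚ ℚ.< ε → ∃[ δ ] (0ℚ ℚ.< δ × B ℚ.* δ ≡ ε)
  scaled B B>0 {ε} 0<ε = 1/B ℚ.* ε
    , ℚ.positive⁻¹ (1/B ℚ.* ε) {{ℚ.pos*pos⇒pos 1/B {{ℚ.1/pos⇒pos B {{B>0}}}} ε {{ℚ.positive 0<ε}}}}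
    , trans (sym (ℚ.*-assoc B 1/B ε))
        (trans (cong (ℚ._* ε) (ℚ.*-inverseʳ B {{ℚ.pos⇒nonZero B {{B>0}}}})) (ℚ.*-identityˡ ε))
    where
    1/B : ℚ
    1/B = (ℚ.1/ B) {{ℚ.pos⇒nonZero B {{B>0}}}}

  *-distribˡ-- : ∀ p q r → p ℚ.* (q ℚ.- r) ≡ p ℚ.* q ℚ.- p ℚ.* r
  *-distribˡ-- p q r = trans (ℚ.*-distribˡ-+ p q (ℚ.- r))
    (cong (p ℚ.* q ℚ.+_) (sym (ℚ.neg-distribʳ-* p r)))

  *-difference : ∀ a b c d → a ℚ.* b ℚ.- c ℚ.* d ≡ a ℚ.* (b ℚ.- d) ℚ.+ d ℚ.* (a ℚ.- c)
  *-difference a b c d = trans (telescope (a ℚ.* b) (a ℚ.* d) (c ℚ.* d))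
    (sym (cong₂ ℚ._+_ (*-distribˡ-- a b d) (trans (*-distribˡ-- d a c)
      (cong₂ ℚ._-_ (ℚ.*-comm d a) (ℚ.*-comm d c)))))
    where
    open +-*-Solver using (solve; _:=_; _:+_; _:-_)
    telescope : ∀ p q r → p ℚ.- r ≡ (p ℚ.- q) ℚ.+ (q ℚ.- r)
    telescope = solve 3 (λ p q r → p :- r := (p :- q) :+ (q :- r)) refl

  ∣p*q∣-bound : ∀ p q {B δ} → 0ℚ ℚ.< δ → ℚ.∣ p ∣ ℚ.≤ B → ℚ.∣ q ∣ ℚ.≤ δ → ℚ.∣ p ℚ.* q ∣ ℚ.≤ B ℚ.* δ
  ∣p*q∣-bound p q {B} {δ} 0<δ hp hq = subst (ℚ._≤ B ℚ.* δ) (sym (ℚ.∣p*q∣≡∣p∣*∣q∣ p q))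
    (*-mono-≤ {ℚ.∣ p ∣} {B} {ℚ.∣ q ∣} {δ} (ℚ.0≤∣p∣ p) (ℚ.<⇒≤ 0<δ) hp hq)

  *-difference-bound : ∀ a b c d {B C δ η} → 0ℚ ℚ.< δ → 0ℚ ℚ.< η →
    ℚ.∣ a ∣ ℚ.≤ B → ℚ.∣ b ℚ.- d ∣ ℚ.≤ δ → ℚ.∣ d ∣ ℚ.≤ C → ℚ.∣ a ℚ.- c ∣ ℚ.≤ η →
    ℚ.∣ a ℚ.* b ℚ.- c ℚ.* d ∣ ℚ.≤ B ℚ.* δ ℚ.+ C ℚ.* η
  *-difference-bound a b c d {B} {C} {δ} {η} 0<δ 0<η ha hbd hd hac =
    subst (λ z → ℚ.∣ z ∣ ℚ.≤ B ℚ.* δ ℚ.+ C ℚ.* η) (sym (*-difference a b c d))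
      (ℚ.≤-trans (ℚ.∣p+q∣≤∣p∣+∣q∣ (a ℚ.* (b ℚ.- d)) (d ℚ.* (a ℚ.- c)))
        (ℚ.+-mono-≤ (∣p*q∣-bound a (b ℚ.- d) {B} {δ} 0<δ ha hbd)
                    (∣p*q∣-bound d (a ℚ.- c) {C} {η} 0<η hd hac)))

  abstract
    *-cauchy : ∀ x y → Cauchy (λ k → seq x k ℚ.* seq y k)
    *-cauchy x y ε 0<ε =
      let B , N₁ , B>0 , hB = bounded x
          C , N₂ , C>0 , hC = bounded y
          δ , δ>0 , Bδ      = scaled B B>0 (half-pos 0<ε)
          η , η>0 , Cη      = scaled C C>0 (half-pos 0<ε)
          M₁ , f            = cauchy y δ δ>0
          M₂ , g            = cauchy x η η>0
      in (N₁ ℕ.⊔ N₂) ℕ.⊔ (M₁ ℕ.⊔ M₂) , λ m n m≥ n≥ →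
        let N≤m = ℕ.m⊔n≤o⇒m≤o (N₁ ℕ.⊔ N₂) (M₁ ℕ.⊔ M₂) m≥
            M≤m = ℕ.m⊔n≤o⇒n≤o (N₁ ℕ.⊔ N₂) (M₁ ℕ.⊔ M₂) m≥
            N≤n = ℕ.m⊔n≤o⇒m≤o (N₁ ℕ.⊔ N₂) (M₁ ℕ.⊔ M₂) n≥
            M≤n = ℕ.m⊔n≤o⇒n≤o (N₁ ℕ.⊔ N₂) (M₁ ℕ.⊔ M₂) n≥
        in subst (ℚ.∣ seq x m ℚ.* seq y m ℚ.- seq x n ℚ.* seq y n ∣ ℚ.≤_)
             (trans (cong₂ ℚ._+_ Bδ Cη) (halves ε))
             (*-difference-bound (seq x m) (seq y m) (seq x n) (seq y n) {B} {C} {δ} {η} δ>0 η>0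
               (hB m (ℕ.m⊔n≤o⇒m≤o N₁ N₂ N≤m))
               (f m n (ℕ.m⊔n≤o⇒m≤o M₁ M₂ M≤m) (ℕ.m⊔n≤o⇒m≤o M₁ M₂ M≤n))
               (hC n (ℕ.m⊔n≤o⇒n≤o N₁ N₂ N≤n))
               (g m n (ℕ.m⊔n≤o⇒n≤o M₁ M₂ M≤m) (ℕ.m⊔n≤o⇒n≤o M₁ M₂ M≤n)))

infixl 6 _+_ _-_
infixl 7 _*_
infix  8 -_

fromℚ : ℚ → ℝ
fromℚ q = real (λ _ → q) (const-cauchy q)

_+_ : ℝ → ℝ → ℝ
x + y = real (λ k → seq x k ℚ.+ seq y k) (+-cauchy x y)

-_ : ℝ → ℝ
- x = real (λ k → ℚ.- seq x k) (neg-cauchy x)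

_-_ : ℝ → ℝ → ℝ
x - y = x + (- y)

_*_ : ℝ → ℝ → ℝ
x * y = real (λ k → seq x k ℚ.* seq y k) (*-cauchy x y)

∣_∣ : ℝ → ℝ
∣ x ∣ = real (λ k → ℚ.∣ seq x k ∣) (abs-cauchy x)

fromℕ : ℕ → ℝ
fromℕ n = fromℚ (+ n ℚ./ 1)

0ℝ 1ℝ 2ℝ ¼ℝ : ℝ
0ℝ = fromℚ 0ℚ
1ℝ = fromℚ 1ℚ
2ℝ = fromℕ 2
¼ℝ = fromℚ (+ 1 ℚ./ 4)

Σℝ : List ℝ → ℝ
Σℝ = foldr _+_ 0ℝ

Σℕ : List ℕ → ℕ
Σℕ = List.sum

-- ⌊log₂ (n ^ k)⌋ / k is within 1 / k of the real number log₂ n, for n ≥ 1.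
log-seq : ℕ → ℕ → ℚ
log-seq n k = + ⌊log₂ (n ℕ.^ suc k) ⌋ ℚ./ suc k

private
  log-bounds : ∀ x → 1 ℕ.≤ x → 2 ℕ.^ ⌊log₂ x ⌋ ℕ.≤ x × x ℕ.< 2 ℕ.^ suc ⌊log₂ x ⌋
  log-bounds = <-rec _ step
    where
    P : ℕ → Set
    P x = 1 ℕ.≤ x → 2 ℕ.^ ⌊log₂ x ⌋ ℕ.≤ x × x ℕ.< 2 ℕ.^ suc ⌊log₂ x ⌋

    double-half : ∀ x → 2 ℕ.* ℕ.⌊ x /2⌋ ℕ.≤ x × suc x ℕ.≤ 2 ℕ.* suc ℕ.⌊ x /2⌋
    double-half zero = ℕ.z≤n , ℕ.s≤s ℕ.z≤n
    double-half (suc zero) = ℕ.z≤n , ℕ.≤-refl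
    double-half (suc (suc x)) with double-half x
    ... | l , u = subst (ℕ._≤ suc (suc x)) (sym (ℕ.*-suc 2 ℕ.⌊ x /2⌋)) (ℕ.s≤s (ℕ.s≤s l))
                , subst (suc (suc (suc x)) ℕ.≤_) (sym (ℕ.*-suc 2 (suc ℕ.⌊ x /2⌋))) (ℕ.s≤s (ℕ.s≤s u))

    step : ∀ x → (∀ {y} → y ℕ.< x → P y) → P x
    step zero _ ()
    step (suc zero) _ _ = ℕ.≤-refl , ℕ.≤-refl
    step x@(suc (suc y)) rec _ with rec (ℕ.⌊n/2⌋<n (suc y)) (ℕ.s≤s ℕ.z≤n)
    ... | l , u = subst (λ L → 2 ℕ.^ L ℕ.≤ x) (sym log-x)
                    (ℕ.≤-trans (ℕ.*-monoʳ-≤ 2 l) (proj₁ (double-half x)))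
                , subst (λ L → x ℕ.< 2 ℕ.^ suc L) (sym log-x)
                    (ℕ.≤-trans (proj₂ (double-half x)) (ℕ.*-monoʳ-≤ 2 u))
      where
      log-x : ⌊log₂ x ⌋ ≡ suc ⌊log₂ ℕ.⌊ x /2⌋ ⌋
      log-x = trans
        (sym (ℕ.m+[n∸m]≡n {1} (⌊log₂⌋-mono-≤ {2} {x} (ℕ.s≤s (ℕ.s≤s ℕ.z≤n)))))
        (cong suc (sym (⌊log₂⌊n/2⌋⌋≡⌊log₂n⌋∸1 x)))

  log-pow : ∀ n a b →
    ⌊log₂ (n ℕ.^ suc a) ⌋ ℕ.* suc b ℕ.≤ suc ⌊log₂ (n ℕ.^ suc b) ⌋ ℕ.* suc a
  log-pow zero a b = ℕ.z≤n
  log-pow n@(suc _) a b = subst₂ ℕ._≤_ (⌊log₂[2^n]⌋≡n _) (⌊log₂[2^n]⌋≡n _) (⌊log₂⌋-mono-≤ (begin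
    2 ℕ.^ (u ℕ.* suc b)           ≡⟨ sym (ℕ.^-*-assoc 2 u (suc b)) ⟩
    (2 ℕ.^ u) ℕ.^ suc b           ≤⟨ ℕ.^-monoˡ-≤ (suc b) (proj₁ (log-bounds _ (ℕ.m^n>0 n (suc a)))) ⟩
    (n ℕ.^ suc a) ℕ.^ suc b       ≡⟨ ℕ.^-*-assoc n (suc a) (suc b) ⟩
    n ℕ.^ (suc a ℕ.* suc b)       ≡⟨ cong (n ℕ.^_) (ℕ.*-comm (suc a) (suc b)) ⟩
    n ℕ.^ (suc b ℕ.* suc a)       ≡⟨ sym (ℕ.^-*-assoc n (suc b) (suc a)) ⟩
    (n ℕ.^ suc b) ℕ.^ suc a       ≤⟨ ℕ.^-monoˡ-≤ (suc a) (ℕ.<⇒≤ (proj₂ (log-bounds _ (ℕ.m^n>0 n (suc b))))) ⟩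
    (2 ℕ.^ suc v) ℕ.^ suc a       ≡⟨ ℕ.^-*-assoc 2 (suc v) (suc a) ⟩
    2 ℕ.^ (suc v ℕ.* suc a)       ∎))
    where
    open ℕ.≤-Reasoning
    u = ⌊log₂ (n ℕ.^ suc a) ⌋
    v = ⌊log₂ (n ℕ.^ suc b) ⌋

  /-mono-≤ : ∀ u a v b → u ℕ.* suc b ℕ.≤ v ℕ.* suc a → (+ u ℚ./ suc a) ℚ.≤ (+ v ℚ./ suc b)
  /-mono-≤ u a v b h = ℚ.toℚᵘ-cancel-≤ (begin
    ℚ.toℚᵘ (+ u ℚ./ suc a)   ≃⟨ ℚ.toℚᵘ-fromℚᵘ (ℚᵘ.mkℚᵘ (+ u) a) ⟩
    ℚᵘ.mkℚᵘ (+ u) a          ≤⟨ ℚᵘ.*≤* (subst₂ ℤ._≤_ (ℤ.pos-* u (suc b)) (ℤ.pos-* v (suc a)) (ℤ.+≤+ h)) ⟩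
    ℚᵘ.mkℚᵘ (+ v) b          ≃⟨ ℚᵘ.≃-sym (ℚ.toℚᵘ-fromℚᵘ (ℚᵘ.mkℚᵘ (+ v) b)) ⟩
    ℚ.toℚᵘ (+ v ℚ./ suc b)   ∎)
    where open ℚᵘ.≤-Reasoning

  suc-/ : ∀ v b → + suc v ℚ./ suc b ≡ (+ v ℚ./ suc b) ℚ.+ (+ 1 ℚ./ suc b)
  suc-/ v b = ℚ.toℚᵘ-injective (begin-equality
    ℚ.toℚᵘ (+ suc v ℚ./ suc b)
      ≃⟨ ℚ.toℚᵘ-fromℚᵘ (ℚᵘ.mkℚᵘ (+ suc v) b) ⟩
    ℚᵘ.mkℚᵘ (+ suc v) b
      ≃⟨ ℚᵘ.*≡* lemma ⟩
    ℚᵘ.mkℚᵘ (+ v) b ℚᵘ.+ ℚᵘ.mkℚᵘ (+ 1) b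
      ≃⟨ ℚᵘ.≃-sym (ℚᵘ.+-cong (ℚ.toℚᵘ-fromℚᵘ (ℚᵘ.mkℚᵘ (+ v) b)) (ℚ.toℚᵘ-fromℚᵘ (ℚᵘ.mkℚᵘ (+ 1) b))) ⟩
    ℚ.toℚᵘ (+ v ℚ./ suc b) ℚᵘ.+ ℚ.toℚᵘ (+ 1 ℚ./ suc b)
      ≃⟨ ℚᵘ.≃-sym (ℚ.toℚᵘ-homo-+ (+ v ℚ./ suc b) (+ 1 ℚ./ suc b)) ⟩
    ℚ.toℚᵘ ((+ v ℚ./ suc b) ℚ.+ (+ 1 ℚ./ suc b)) ∎)
    where
    open ℚᵘ.≤-Reasoning
    d = + suc b
    lemma : + suc v ℤ.* (d ℤ.* d) ≡ (+ v ℤ.* d ℤ.+ + 1 ℤ.* d) ℤ.* d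
    lemma = trans (sym (ℤ.*-assoc (+ suc v) d d)) (cong (ℤ._* d)
      (trans (cong (ℤ._* d) (cong +_ (ℕ.+-comm 1 v))) (ℤ.*-distribʳ-+ d (+ v) (+ 1))))

  archimedean : ∀ ε → 0ℚ ℚ.< ε → ∃[ N ] (∀ n → N ℕ.≤ n → (+ 1 ℚ./ suc n) ℚ.≤ ε)
  archimedean ε@(mkℚ (+ zero) d _) (ℚ.*<* (ℤ.+<+ ()))
  archimedean ε@(mkℚ +[1+ k ] d _) _ = d , λ n d≤n →
    subst ((+ 1 ℚ./ suc n) ℚ.≤_) (ℚ.fromℚᵘ-toℚᵘ ε)
      (/-mono-≤ 1 n (suc k) d
        (ℕ.*-mono-≤ (ℕ.s≤s (ℕ.z≤n {k})) (ℕ.s≤s d≤n)))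
  archimedean (mkℚ ℤ.-[1+ _ ] _ _) (ℚ.*<* ())

  abstract
    log-cauchy : ∀ n → Cauchy (log-seq n)
    log-cauchy n ε 0<ε with archimedean ε 0<ε
    ... | N , f = N , λ a b a≥ b≥ →
        ∣-∣-bound (log-seq n a) (log-seq n b) (close a b b≥) (close b a a≥)
      where
      close : ∀ a b → N ℕ.≤ b → log-seq n a ℚ.≤ log-seq n b ℚ.+ ε
      close a b b≥ = begin
        log-seq n a
          ≤⟨ /-mono-≤ ⌊log₂ (n ℕ.^ suc a) ⌋ a (suc ⌊log₂ (n ℕ.^ suc b) ⌋) b (log-pow n a b) ⟩
        + suc ⌊log₂ (n ℕ.^ suc b) ⌋ ℚ./ suc b
          ≡⟨ suc-/ ⌊log₂ (n ℕ.^ suc b) ⌋ b ⟩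
        log-seq n b ℚ.+ (+ 1 ℚ./ suc b)
          ≤⟨ ℚ.+-monoʳ-≤ (log-seq n b) (f b b≥) ⟩
        log-seq n b ℚ.+ ε ∎
        where open ℚ.≤-Reasoning

-- Junk value 0 at n = 0.
log₂ : ℕ → ℝ
log₂ n = real (log-seq n) (log-cauchy n)

_∈o[_] : (ℕ → ℝ) → (ℕ → ℝ) → Set
g ∈o[ h ] = ∀ ε → 0ℝ < ε → ∃[ N ] (∀ n → N ℕ.≤ n → ∣ g n ∣ ≤ ε * ∣ h n ∣)

private
  variable
    n : ℕ

-- A pattern p ∈ {0,1}ⁿ is encoded as the subset of the items it contains.

Sizes : ℕ → Set
Sizes n = Fin n → ℝ

record IsSizes (s : Sizes n) : Set where
  field
    nonneg : ∀ i → 0ℝ ≤ s i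
    ≤one   : ∀ i → s i ≤ 1ℝ
    sorted : ∀ i j → i Fin.≤ j → s j ≤ s i

total : Sizes n → Subset n → ℝ
total {n} s p = Σℝ (map s (filter (_∈? p) (allFin n)))

Feasible : Sizes n → Pred (Subset n) _
Feasible s p = total s p ≤ 1ℝ

allSubsets : ∀ n → List (Subset n)
allSubsets zero    = [] ∷ []
allSubsets (suc n) = map (outside ∷_) (allSubsets n) ++ map (inside ∷_) (allSubsets n)

containing : Fin n → List (Subset n)
containing {n} i = filter (i ∈?_) (allSubsets n)

-- Feasibility of a pattern is an undecidable comparison of reals, so a vector
-- indexed by the feasible patterns is a function on all subsets that vanishes
-- on the infeasible ones; sums over 𝒫 may then range over all subsets.

record IsFractionalSolution (s : Sizes n) (y : Subset n → ℝ) : Set where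
  field
    nonneg  : ∀ p → 0ℝ ≤ y p
    ≤one    : ∀ p → y p ≤ 1ℝ
    vanish  : ∀ p → ¬ Feasible s p → y p ≃ 0ℝ
    covers  : ∀ i → 1ℝ ≤ Σℝ (map y (containing i))

record Instance (n : ℕ) : Set where
  field
    s            : Sizes n
    isSizes      : IsSizes s
    y            : Subset n → ℝ
    isFractional : IsFractionalSolution s y

suppℝ : Sizes n → (Subset n → ℝ) → Pred (Subset n) _
suppℝ s y p = Feasible s p × y p ≄ 0ℝ

suppℕ : Sizes n → (Subset n → ℕ) → Pred (Subset n) _
suppℕ s x p = Feasible s p × x p ≢ 0

-- Only the values of σ outside D are constrained or counted.
preimageSize : Subset n → (Fin n → Fin n) → Fin n → ℕ
preimageSize {n} D σ i = length (filter (λ j → ¬? (j ∈? D) ×-dec (σ j Fin.≟ i)) (allFin n))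

Covers : (Subset n → ℕ) → Subset n → Set
Covers {n} x D = Σ[ σ ∈ (Fin n → Fin n) ]
    (∀ i → i ∉ D → σ i Fin.≤ i)
  × (∀ i → preimageSize D σ i ℕ.≤ Σℕ (map x (containing i)))

record Rounding (I : Instance n) : Set where
  open Instance I
  field
    x       : Subset n → ℕ
    D       : Subset n
    vanish  : ∀ p → ¬ Feasible s p → x p ≡ 0
    support : suppℕ s x ⊆ suppℝ s y
    covers  : Covers x D

RoundingUpAlgorithm : Set
RoundingUpAlgorithm = ∀ {n} (I : Instance n) → Rounding I

gap : (I : Instance n) → Rounding I → ℝ
gap {n} I R = fromℕ (Σℕ (map x (allSubsets n))) + 2ℝ * total s D - Σℝ (map y (allSubsets n))
  where
  open Instance I
  open Rounding R

AchievesGap : RoundingUpAlgorithm → (ℕ → ℝ) → Set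
AchievesGap A g = ∀ {n} (I : Instance n) → (∀ i → ¼ℝ < Instance.s I i) → gap I (A I) ≤ g n

{-# OPTIONS --safe #-}

-- All items have size 1/3, so a pattern is any set of at most three items and only the
-- order of the items matters. The 3^k ternary strings of length k are put in three orders,
-- which cyclically permute the letters, and the pattern of a string consists of one item
-- for each order, namely its position there divided by 2. All patterns get the value 1/2.
-- An integral x turns into a colouring χ = 2x - 1 of the strings, and because items may only
-- be rounded up, every prefix of every order has χ-sum at least -O(gap). On the other hand
-- (after Newman, Neiman and Nikolov) three prefixes, one in each order, have a small total:
-- if the blocks of the first letter have χ-sums a, b, c, then recursing into the block of a
-- costs b + 2c, that of b costs c + 2a and that of c costs a + 2b. Since a, b, c are odd, the
-- best choice decreases the potential 12 T + |T|, where T is the total χ-sum, relative to 8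
-- times the prefix sums by 2 on each level. So the gap is at least linear in k.
module Submission where

open import Defs hiding (_≤_; _<_; _+_; _*_; _-_; -_; ∣_∣)
import Defs as R
open import Data.Nat.Base as ℕ using (ℕ; zero; suc; z≤n; s≤s; ⌊_/2⌋)
import Data.Nat.Properties as ℕ
open import Data.Nat.Logarithm using (⌊log₂_⌋; ⌊log₂⌋-mono-≤; ⌊log₂[2^n]⌋≡n)
import Data.Nat.Tactic.RingSolver as ℕ-Solver
open import Data.Integer.Base as ℤ using (ℤ)
import Data.Integer.Properties as ℤ
import Data.Integer.Tactic.RingSolver as ℤ-Solver
import Data.Rational.Unnormalised.Base as ℚᵘ
import Data.Rational.Unnormalised.Properties as ℚᵘ
open import Data.Rational.Literals using (fromℤ)
open import Data.Rational.Solver using (module +-*-Solver)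
open import Data.Bool.Base using (true)
import Data.Bool.Properties as Bool
open import Data.Fin.Base as Fin using (Fin; zero; suc; toℕ)
open import Data.Fin.Patterns using (0F; 1F; 2F)
import Data.Fin.Properties as Fin
open import Data.Fin.Subset using (Subset; inside; outside; _∈_; _∉_)
open import Data.Fin.Subset.Properties using (_∈?_)
open import Data.List.Base using (List; []; _∷_; _++_; map; filter; length; allFin)
open import Data.List.Properties using (map-++; map-∘; map-cong; map-tabulate)
open import Data.List.Membership.Propositional using () renaming (_∈_ to _∈ˡ_)
open import Data.List.Membership.Propositional.Properties using (∈-map⁺; ∈-++⁺ˡ; ∈-++⁺ʳ; ∈-allFin)
open import Data.List.Relation.Unary.Any using (here; there)
open import Data.Nat.ListAction using (sum)
open import Data.Nat.ListAction.Properties using (sum-++)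
open import Data.Vec.Base using (Vec; []; _∷_; tabulate)
open import Data.Vec.Properties using (≡-dec; ∷-injectiveˡ; ∷-injectiveʳ; lookup∘tabulate; []=⇒lookup; lookup⇒[]=)
open import Data.Product.Base using (Σ-syntax; ∃-syntax; _×_; _,_; proj₁; proj₂)
open import Data.Sum.Base as Sum using (_⊎_; inj₁; inj₂)
open import Data.Empty using (⊥-elim)
open import Function.Base using (_∘_; case_of_)
open import Relation.Nullary using (¬_; Dec; yes; no; does; ¬?; _×-dec_)
open import Relation.Nullary.Decidable using (dec-true; from-yes)
open import Relation.Unary using (Decidable)
open import Relation.Binary.PropositionalEquality

private
  variable
    A B : Set

-- Finite sums of natural numbers and indicators of decidable propositions.

module Sums where

  open import Data.Nat.Base using (_+_; _*_; _≤_; _⊓_)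
  open import Data.Nat.Properties
  open ℕ-Solver using (solve-∀)

  ∑ : List A → (A → ℕ) → ℕ
  ∑ xs f = sum (map f xs)

  syntax ∑ xs (λ x → e) = ∑[ x ← xs ] e

  ∑-++ : ∀ (xs ys : List A) f → ∑ (xs ++ ys) f ≡ ∑ xs f + ∑ ys f
  ∑-++ xs ys f = trans (cong sum (map-++ f xs ys)) (sum-++ (map f xs) (map f ys))

  ∑-map : ∀ (g : A → B) xs f → ∑ (map g xs) f ≡ ∑ xs (f ∘ g)
  ∑-map g xs f = cong sum (sym (map-∘ xs))

  ∑-cong : ∀ (xs : List A) {f g} → (∀ x → f x ≡ g x) → ∑ xs f ≡ ∑ xs g
  ∑-cong xs eq = cong sum (map-cong eq xs)

  ∑-mono : ∀ (xs : List A) {f g} → (∀ x → f x ≤ g x) → ∑ xs f ≤ ∑ xs g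
  ∑-mono []       _  = z≤n
  ∑-mono (x ∷ xs) le = +-mono-≤ (le x) (∑-mono xs le)

  ∑-zero : ∀ (xs : List A) {f} → (∀ x → f x ≡ 0) → ∑ xs f ≡ 0
  ∑-zero []       _  = refl
  ∑-zero (x ∷ xs) eq = cong₂ _+_ (eq x) (∑-zero xs eq)

  ∑-+ : ∀ (xs : List A) f g → ∑[ x ← xs ] (f x + g x) ≡ ∑ xs f + ∑ xs g
  ∑-+ []       f g = refl
  ∑-+ (x ∷ xs) f g = trans (cong (f x + g x +_) (∑-+ xs f g)) (interchange (f x) (g x) _ _)
    where
    interchange : ∀ a b c d → a + b + (c + d) ≡ a + c + (b + d)
    interchange = solve-∀

  ∑-*ˡ : ∀ (xs : List A) c f → ∑[ x ← xs ] (c * f x) ≡ c * ∑ xs f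
  ∑-*ˡ []       c f = sym (*-zeroʳ c)
  ∑-*ˡ (x ∷ xs) c f = trans (cong (c * f x +_) (∑-*ˡ xs c f)) (sym (*-distribˡ-+ c (f x) _))

  ∑-*ʳ : ∀ (xs : List A) c f → ∑[ x ← xs ] (f x * c) ≡ ∑ xs f * c
  ∑-*ʳ xs c f = trans (∑-cong xs (λ x → *-comm (f x) c)) (trans (∑-*ˡ xs c f) (*-comm c _))

  ∑-swap : ∀ (xs : List A) (ys : List B) (f : A → B → ℕ) →
    ∑[ x ← xs ] ∑[ y ← ys ] f x y ≡ ∑[ y ← ys ] ∑[ x ← xs ] f x y
  ∑-swap []       ys f = sym (∑-zero ys (λ _ → refl))
  ∑-swap (x ∷ xs) ys f = trans (cong (∑ ys (f x) +_) (∑-swap xs ys f))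
    (sym (∑-+ ys (f x) (λ y → ∑[ x′ ← xs ] f x′ y)))

  ∑-one : ∀ (xs : List A) → ∑[ _ ← xs ] 1 ≡ length xs
  ∑-one []       = refl
  ∑-one (_ ∷ xs) = cong suc (∑-one xs)

  ∑-∈ : ∀ {xs : List A} {x} f → x ∈ˡ xs → f x ≤ ∑ xs f
  ∑-∈ f (here refl) = m≤m+n _ _
  ∑-∈ f (there x∈)  = m≤n⇒m≤o+n _ (∑-∈ f x∈)

  𝟙 : ∀ {P : Set} → Dec P → ℕ
  𝟙 (yes _) = 1
  𝟙 (no _)  = 0

  𝟙-yes : ∀ {P : Set} (P? : Dec P) → P → 𝟙 P? ≡ 1
  𝟙-yes (yes _) _ = refl
  𝟙-yes (no ¬p) p = ⊥-elim (¬p p)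

  𝟙-no : ∀ {P : Set} (P? : Dec P) → ¬ P → 𝟙 P? ≡ 0
  𝟙-no (yes p) ¬p = ⊥-elim (¬p p)
  𝟙-no (no _)  _  = refl

  𝟙≤1 : ∀ {P : Set} (P? : Dec P) → 𝟙 P? ≤ 1
  𝟙≤1 (yes _) = s≤s z≤n
  𝟙≤1 (no _)  = z≤n

  𝟙*≤ : ∀ {P : Set} (P? : Dec P) n → 𝟙 P? * n ≤ n
  𝟙*≤ P? n = ≤-trans (*-monoˡ-≤ n (𝟙≤1 P?)) (≤-reflexive (*-identityˡ n))

  𝟙-mono : ∀ {P Q : Set} (P? : Dec P) (Q? : Dec Q) → (P → Q) → 𝟙 P? ≤ 𝟙 Q?
  𝟙-mono (yes p) Q? f = ≤-reflexive (sym (𝟙-yes Q? (f p)))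
  𝟙-mono (no _)  Q? f = z≤n

  ∑-filter : ∀ {P : A → Set} (P? : Decidable P) xs f → ∑ (filter P? xs) f ≡ ∑[ x ← xs ] (𝟙 (P? x) * f x)
  ∑-filter P? []       f = refl
  ∑-filter P? (x ∷ xs) f with P? x
  ... | yes _ = cong₂ _+_ (sym (*-identityˡ (f x))) (∑-filter P? xs f)
  ... | no _  = ∑-filter P? xs f

  length-filter : ∀ {P : A → Set} (P? : Decidable P) xs → length (filter P? xs) ≡ ∑[ x ← xs ] 𝟙 (P? x)
  length-filter P? xs = trans (sym (∑-one (filter P? xs)))
    (trans (∑-filter P? xs (λ _ → 1)) (∑-cong xs (λ x → *-identityʳ _)))

  ∑-nonzero : ∀ (xs : List A) f → ∑ xs f ≢ 0 → ∃[ x ] f x ≢ 0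
  ∑-nonzero []       f ≢0 = ⊥-elim (≢0 refl)
  ∑-nonzero (x ∷ xs) f ≢0 with f x ≟ 0
  ... | no fx≢0  = x , fx≢0
  ... | yes fx≡0 = ∑-nonzero xs f (λ eq → ≢0 (cong₂ _+_ fx≡0 eq))

  -- Truncation at `c` is subadditive. Hence multiplicities truncated at 2 still cover an item
  -- twice.
  ∑-⊓ : ∀ (xs : List A) c f → c ⊓ ∑ xs f ≤ ∑[ x ← xs ] (c ⊓ f x)
  ∑-⊓ []       c f = m⊓n≤n c 0
  ∑-⊓ (x ∷ xs) c f = ≤-trans (lemma c (f x) (∑ xs f)) (+-monoʳ-≤ (c ⊓ f x) (∑-⊓ xs c f))
    where
    lemma : ∀ c a b → c ⊓ (a + b) ≤ c ⊓ a + c ⊓ b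
    lemma zero    a       b = z≤n
    lemma (suc c) zero    b = ≤-refl
    lemma (suc c) (suc a) b = s≤s (≤-trans (lemma c a b) (+-monoʳ-≤ (c ⊓ a) (⊓-monoˡ-≤ b (n≤1+n c))))

  sum₃ : (Fin 3 → ℕ) → ℕ
  sum₃ f = f 0F + f 1F + f 2F

  ∑-sum₃ : ∀ (xs : List A) (f : A → Fin 3 → ℕ) →
    ∑[ x ← xs ] sum₃ (f x) ≡ sum₃ (λ t → ∑[ x ← xs ] f x t)
  ∑-sum₃ xs f = trans (∑-+ xs (λ x → f x 0F + f x 1F) (λ x → f x 2F))
    (cong (_+ ∑[ x ← xs ] f x 2F) (∑-+ xs (λ x → f x 0F) (λ x → f x 1F)))

open Sums

-- Ternary strings, their three orders, and the weights of prefixes.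

module Orders where

  open import Data.Nat.Base using (_+_; _*_; _^_; _≤_; _<_)
  open import Data.Nat.Properties
  open ℕ-Solver using (solve-∀)

  Word : ℕ → Set
  Word = Vec (Fin 3)

  words : ∀ k → List (Word k)
  words zero    = [] ∷ []
  words (suc k) = map (0F ∷_) (words k) ++ map (1F ∷_) (words k) ++ map (2F ∷_) (words k)

  words-complete : ∀ {k} (v : Word k) → v ∈ˡ words k
  words-complete [] = here refl
  words-complete {suc k} (0F ∷ v) = ∈-++⁺ˡ (∈-map⁺ _ (words-complete v))
  words-complete {suc k} (1F ∷ v) = ∈-++⁺ʳ (map (0F ∷_) (words k)) (∈-++⁺ˡ (∈-map⁺ _ (words-complete v)))
  words-complete {suc k} (2F ∷ v) = ∈-++⁺ʳ (map (0F ∷_) (words k))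
    (∈-++⁺ʳ (map (1F ∷_) (words k)) (∈-map⁺ _ (words-complete v)))

  ∑-words : ∀ k f → ∑ (words (suc k)) f ≡
    ∑[ v ← words k ] f (0F ∷ v) + (∑[ v ← words k ] f (1F ∷ v) + ∑[ v ← words k ] f (2F ∷ v))
  ∑-words k f = trans (∑-++ (map (0F ∷_) (words k)) _ f) (cong₂ _+_ (∑-map (0F ∷_) (words k) f)
    (trans (∑-++ (map (1F ∷_) (words k)) _ f)
      (cong₂ _+_ (∑-map (1F ∷_) (words k) f) (∑-map (2F ∷_) (words k) f))))

  length-words : ∀ k → ∑[ _ ← words k ] 1 ≡ 3 ^ k
  length-words zero    = refl
  length-words (suc k) = trans (∑-words k (λ _ → 1))
    (cong₂ _+_ (length-words k) (cong₂ _+_ (length-words k) (trans (length-words k) (sym (+-identityʳ _)))))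

  -- The strings are ordered lexicographically in three ways, with the letters
  -- sorted as 0 1 2, as 2 0 1 and as 1 2 0.
  rank : Fin 3 → Fin 3 → ℕ
  rank 0F 0F = 0
  rank 0F 1F = 1
  rank 0F 2F = 2
  rank 1F 0F = 1
  rank 1F 1F = 2
  rank 1F 2F = 0
  rank 2F 0F = 2
  rank 2F 1F = 0
  rank 2F 2F = 1

  rank≤2 : ∀ t d → rank t d ≤ 2
  rank≤2 0F 0F = z≤n
  rank≤2 0F 1F = s≤s z≤n
  rank≤2 0F 2F = s≤s (s≤s z≤n)
  rank≤2 1F 0F = s≤s z≤n
  rank≤2 1F 1F = s≤s (s≤s z≤n)
  rank≤2 1F 2F = z≤n
  rank≤2 2F 0F = s≤s (s≤s z≤n)
  rank≤2 2F 1F = z≤n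
  rank≤2 2F 2F = s≤s z≤n

  -- The ranks of the letters are the base 3 digits of the position, which is counted from 0.
  pos : ∀ {k} → Fin 3 → Word k → ℕ
  pos         t []      = 0
  pos {suc k} t (d ∷ v) = rank t d * 3 ^ k + pos t v

  letter : ∀ t r → r < 3 → ∃[ d ] rank t d ≡ r
  letter 0F 0 _ = 0F , refl
  letter 0F 1 _ = 1F , refl
  letter 0F 2 _ = 2F , refl
  letter 1F 0 _ = 2F , refl
  letter 1F 1 _ = 0F , refl
  letter 1F 2 _ = 1F , refl
  letter 2F 0 _ = 1F , refl
  letter 2F 1 _ = 2F , refl
  letter 2F 2 _ = 0F , refl
  letter t (suc (suc (suc r))) (s≤s (s≤s (s≤s ())))

  quotient-remainder : ∀ r n e → e < r * n → ∃[ q ] ∃[ e′ ] (q < r × e′ < n × q * n + e′ ≡ e)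
  quotient-remainder zero    n e ()
  quotient-remainder (suc r) n e e< with e <? n
  ... | yes e<n = 0 , e , s≤s z≤n , e<n , refl
  ... | no  e≮n with m≤n⇒∃[o]m+o≡n (≮⇒≥ e≮n)
  ... | e″ , refl with quotient-remainder r n e″ (+-cancelˡ-< n e″ (r * n) e<)
  ... | q , e′ , q< , e′< , refl = suc q , e′ , s≤s q< , e′< , +-assoc n (q * n) e′

  pos-surjective : ∀ k t e → e < 3 ^ k → Σ[ v ∈ Word k ] pos t v ≡ e
  pos-surjective zero    t zero _ = [] , refl
  pos-surjective zero    t (suc e) (s≤s ())
  pos-surjective (suc k) t e e< with quotient-remainder 3 (3 ^ k) e e<
  ... | q , e′ , q< , e′< , refl with letter t q q< | pos-surjective k t e′ e′<
  ... | d , refl | v , refl = d ∷ v , refl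

  pre : ∀ k → Fin 3 → ℕ → (Word k → ℕ) → ℕ
  pre k t e w = ∑[ v ← words k ] (𝟙 (pos t v <? e) * w v)

  module _ {k : ℕ} (t : Fin 3) (w : Word k → ℕ) {e : ℕ} where

    private
      N : ℕ
      N = 3 ^ k

      -- This is the part of a prefix that lies in the block of rank `ρ`, when the prefix ends `e`
      -- places into the block of rank `r`. The three lemmas below bound it for blocks before, at
      -- and after the end of the prefix.
      block : ℕ → ℕ → ℕ
      block ρ r = ∑[ v ← words k ] (𝟙 (ρ * N + pos t v <? r * N + e) * w v)

    block-any : ∀ ρ r → block ρ r ≤ ∑ (words k) w
    block-any ρ r = ∑-mono (words k) (λ v → 𝟙*≤ (ρ * N + pos t v <? r * N + e) (w v))

    block-same : ∀ r → block r r ≤ pre k t e w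
    block-same r = ∑-mono (words k) (λ v → *-monoˡ-≤ (w v)
      (𝟙-mono (r * N + pos t v <? r * N + e) (pos t v <? e) (+-cancelˡ-< (r * N) (pos t v) e)))

    block-after : ∀ {ρ r} → r < ρ → e ≤ N → block ρ r ≤ 0
    block-after {ρ} {r} r<ρ e≤N = ≤-reflexive (∑-zero (words k) (λ v → cong (_* w v)
      (𝟙-no (ρ * N + pos t v <? r * N + e) (≤⇒≯ (begin
        r * N + e       ≤⟨ +-monoʳ-≤ (r * N) e≤N ⟩
        r * N + N       ≡⟨ +-comm (r * N) N ⟩
        suc r * N       ≤⟨ *-monoˡ-≤ N r<ρ ⟩
        ρ * N           ≤⟨ m≤m+n (ρ * N) (pos t v) ⟩
        ρ * N + pos t v ∎)))))
      where open ≤-Reasoning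

  before : Fin 3 → Fin 3 → (Fin 3 → ℕ) → ℕ
  before 0F 0F W = 0
  before 0F 1F W = W 0F
  before 0F 2F W = W 0F + W 1F
  before 1F 0F W = W 2F
  before 1F 1F W = W 2F + W 0F
  before 1F 2F W = 0
  before 2F 0F W = W 1F + W 2F
  before 2F 1F W = 0
  before 2F 2F W = W 1F

  -- A prefix that ends inside the block of `d` is made of the blocks before it and a prefix of that
  -- block. This reduces prefixes to strings that are shorter by one letter.
  pre-block : ∀ k t d e (w : Word (suc k) → ℕ) → e ≤ 3 ^ k →
    pre (suc k) t (rank t d * 3 ^ k + e) w ≤
    before t d (λ d′ → ∑[ v ← words k ] w (d′ ∷ v)) + pre k t e (λ v → w (d ∷ v))
  pre-block k t d e w e≤N = ≤-trans
    (≤-reflexive (∑-words k (λ v → 𝟙 (pos t v <? rank t d * 3 ^ k + e) * w v))) (go t d)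
    where
    open ≤-Reasoning

    b : Fin 3 → Fin 3 → Fin 3 → ℕ
    b t d d′ = ∑[ v ← words k ] (𝟙 (rank t d′ * 3 ^ k + pos t v <? rank t d * 3 ^ k + e) * w (d′ ∷ v))

    W : Fin 3 → ℕ
    W d′ = ∑[ v ← words k ] w (d′ ∷ v)

    any : ∀ t d d′ → b t d d′ ≤ W d′
    any t d d′ = block-any t (λ v → w (d′ ∷ v)) (rank t d′) (rank t d)

    same : ∀ t d → b t d d ≤ pre k t e (λ v → w (d ∷ v))
    same t d = block-same t (λ v → w (d ∷ v)) (rank t d)

    after : ∀ t d d′ → rank t d < rank t d′ → b t d d′ ≤ 0
    after t d d′ lt = block-after t (λ v → w (d′ ∷ v)) lt e≤N

    assoc-comm : ∀ x y p → x + (p + y) ≡ y + x + p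
    assoc-comm = solve-∀

    go : ∀ t d → b t d 0F + (b t d 1F + b t d 2F) ≤ before t d W + pre k t e (λ v → w (d ∷ v))
    go 0F 0F = ≤-trans (+-mono-≤ (same 0F 0F) (+-mono-≤ (after 0F 0F 1F (s≤s z≤n)) (after 0F 0F 2F (s≤s z≤n))))
       (≤-reflexive (+-identityʳ _))
    go 0F 1F = +-mono-≤ (any 0F 1F 0F) (≤-trans (+-mono-≤ (same 0F 1F) (after 0F 1F 2F (s≤s (s≤s z≤n))))
       (≤-reflexive (+-identityʳ _)))
    go 0F 2F = ≤-trans (+-mono-≤ (any 0F 2F 0F) (+-mono-≤ (any 0F 2F 1F) (same 0F 2F)))
       (≤-reflexive (sym (+-assoc (W 0F) (W 1F) _)))
    go 1F 0F = ≤-trans (+-mono-≤ (same 1F 0F) (+-mono-≤ (after 1F 0F 1F (s≤s (s≤s z≤n))) (any 1F 0F 2F)))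
       (≤-reflexive (+-comm _ (W 2F)))
    go 1F 1F = ≤-trans (+-mono-≤ (any 1F 1F 0F) (+-mono-≤ (same 1F 1F) (any 1F 1F 2F)))
       (≤-reflexive (assoc-comm (W 0F) (W 2F) _))
    go 1F 2F = +-mono-≤ (after 1F 2F 0F (s≤s z≤n)) (+-mono-≤ (after 1F 2F 1F (s≤s z≤n)) (same 1F 2F))
    go 2F 0F = ≤-trans (+-mono-≤ (same 2F 0F) (+-mono-≤ (any 2F 0F 1F) (any 2F 0F 2F)))
       (≤-reflexive (+-comm _ (W 1F + W 2F)))
    go 2F 1F = ≤-trans (+-mono-≤ (after 2F 1F 0F (s≤s z≤n)) (+-mono-≤ (same 2F 1F) (after 2F 1F 2F (s≤s z≤n))))
       (≤-reflexive (+-identityʳ _))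
    go 2F 2F = +-mono-≤ (after 2F 2F 0F (s≤s (s≤s z≤n))) (+-mono-≤ (any 2F 2F 1F) (same 2F 2F))

  -- The number (3^k - 1) / 2 of pairs of consecutive positions in an order. As 3^k is odd, one
  -- position is left over.
  half : ℕ → ℕ
  half zero    = 0
  half (suc k) = 1 + 3 * half k

  3^k≡1+2half : ∀ k → 3 ^ k ≡ 1 + 2 * half k
  3^k≡1+2half zero    = refl
  3^k≡1+2half (suc k) = trans (cong (3 *_) (3^k≡1+2half k)) (lemma (half k))
    where
    lemma : ∀ h → 3 * (1 + 2 * h) ≡ 1 + 2 * (1 + 3 * h)
    lemma = solve-∀

open Orders

-- The integer inequality behind one level of the recursion.

module Drops where

  open import Data.Integer.Base using (+_; -[1+_]; 0ℤ; _+_; _-_; _*_; -_; _≤_; ∣_∣; -≤+; +≤+)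
  open import Data.Integer.Properties
  open ℤ-Solver using (solve-∀)

  ≤-by : ∀ {i j} r → 0ℤ ≤ r → j ≡ i + r → i ≤ j
  ≤-by {i} r 0≤r refl = subst (_≤ i + r) (+-identityʳ i) (+-monoʳ-≤ i 0≤r)

  ≤⇒+ : ∀ {i j} → i ≤ j → ∃[ n ] j ≡ i + + n
  ≤⇒+ {i} {j} i≤j = ∣ j - i ∣ ,
    trans (lemma i j) (cong (λ k → i + k) (sym (0≤i⇒+∣i∣≡i (i≤j⇒0≤j-i i≤j))))
    where
    lemma : ∀ i j → j ≡ i + (j - i)
    lemma = solve-∀

  i≤+∣i∣ : ∀ i → i ≤ + ∣ i ∣
  i≤+∣i∣ (+ n)    = ≤-refl
  i≤+∣i∣ -[1+ n ] = -≤+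

  -i≤+∣i∣ : ∀ i → - i ≤ + ∣ i ∣
  -i≤+∣i∣ i = subst (λ k → - i ≤ + k) (∣-i∣≡∣i∣ i) (i≤+∣i∣ (- i))

  -- With odd numbers written in this form, parity is a substitution instead of a hypothesis. It is
  -- the source of the `+ 2` in `Drop`, which fails when all three sums are 0.
  odd : ℤ → ℤ
  odd α = + 1 + + 2 * α

  0≤linear : ∀ b u c v n → 0ℤ ≤ + 4 * + n + + b * + u + + c * + v
  0≤linear b u c v n = subst (0ℤ ≤_) (cong₂ _+_ (cong₂ _+_ (pos-* 4 n) (pos-* b u)) (pos-* c v)) (+≤+ z≤n)

  -- For T = odd α + odd β + odd γ this reads 4 (odd γ − odd β) + |odd α| + 2 ≤ |T|.
  record Drop (T α β γ : ℤ) : Set where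
    constructor dropped
    field
      bound : + 8 * (γ - β) + + ∣ odd α ∣ + + 2 ≤ + ∣ T ∣

  -- For α = n and for α = −1 − n the slack in the inequality is 4 n + b u + c v and
  -- 4 n + b′ u + c′ v, respectively.
  drop-by : ∀ T α β γ b c b′ c′ u v →
    T ≡ + 8 * (γ - β) + odd α + + 2 + (+ 4 * α + + b * + u + + c * + v) →
    - T ≡ + 8 * (γ - β) + - odd α + + 2 + (+ 4 * (- (+ 1 + α)) + + b′ * + u + + c′ * + v) →
    Drop T α β γ
  drop-by T (+ n) β γ b c b′ c′ u v h⁺ _ = dropped (≤-trans
    (≤-by (+ 4 * + n + + b * + u + + c * + v) (0≤linear b u c v n)
      (trans h⁺ (cong (λ i → + 8 * (γ - β) + i + + 2 + (+ 4 * + n + + b * + u + + c * + v)) (sym ∣odd∣))))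
    (i≤+∣i∣ T))
    where
    ∣odd∣ : + ∣ odd (+ n) ∣ ≡ odd (+ n)
    ∣odd∣ = 0≤i⇒+∣i∣≡i (subst (λ i → 0ℤ ≤ + 1 + i) (pos-* 2 n) (+≤+ z≤n))
  drop-by T -[1+ n ] β γ b c b′ c′ u v _ h⁻ = dropped (≤-trans
    (≤-by (+ 4 * + n + + b′ * + u + + c′ * + v) (0≤linear b′ u c′ v n)
      (trans h⁻ (cong₂ (λ i m → + 8 * (γ - β) + i + + 2 + (+ 4 * m + + b′ * + u + + c′ * + v))
        (sym ∣odd∣) (flip (+ n)))))
    (-i≤+∣i∣ T))
    where
    lemma : ∀ m → - (+ 1 + + 2 * (- (+ 1 + m))) ≡ + 1 + + 2 * m
    lemma = solve-∀
    flip : ∀ m → - (+ 1 + - (+ 1 + m)) ≡ m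
    flip = solve-∀
    0≤-odd : 0ℤ ≤ - odd -[1+ n ]
    0≤-odd = subst (0ℤ ≤_) (sym (lemma (+ n))) (subst (λ i → 0ℤ ≤ + 1 + i) (pos-* 2 n) (+≤+ z≤n))
    ∣odd∣ : + ∣ odd -[1+ n ] ∣ ≡ - odd -[1+ n ]
    ∣odd∣ = trans (cong +_ (sym (∣-i∣≡∣i∣ (odd -[1+ n ])))) (0≤i⇒+∣i∣≡i 0≤-odd)

  -- The choice is the most negative of the cyclic differences `γ - β`, `α - γ` and `β - α`. The
  -- second is nonnegative here because `α` is the largest, and if `β ≤ γ` then the third is the
  -- smallest.
  drop-max : ∀ α β γ → β ≤ α → γ ≤ α →
    Drop (odd α + odd β + odd γ) α β γ ⊎ Drop (odd α + odd β + odd γ) γ α β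
  drop-max α β γ β≤α γ≤α with ≤-total γ β
  drop-max α β γ β≤α γ≤α | inj₂ β≤γ with ≤⇒+ β≤γ | ≤⇒+ γ≤α
  ... | v , refl | u , refl = inj₂ (drop-by _ (β + + v) (β + + v + + u) β 10 6 6 10 u v
          (h⁺ β (+ u) (+ v)) (h⁻ β (+ u) (+ v)))
    where
    h⁺ : ∀ β u v →
      (+ 1 + + 2 * (β + v + u)) + (+ 1 + + 2 * β) + (+ 1 + + 2 * (β + v)) ≡
      + 8 * (β - (β + v + u)) + (+ 1 + + 2 * (β + v)) + + 2 + (+ 4 * (β + v) + + 10 * u + + 6 * v)
    h⁺ = solve-∀
    h⁻ : ∀ β u v →
      - ((+ 1 + + 2 * (β + v + u)) + (+ 1 + + 2 * β) + (+ 1 + + 2 * (β + v))) ≡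
      + 8 * (β - (β + v + u)) + - (+ 1 + + 2 * (β + v)) + + 2 + (+ 4 * (- (+ 1 + (β + v))) + + 6 * u + + 10 * v)
    h⁻ = solve-∀
  drop-max α β γ β≤α γ≤α | inj₁ γ≤β with ≤⇒+ γ≤β | ≤⇒+ β≤α
  ... | v , refl | u , refl with ℕ.≤-total u v
  -- For a nonnegative first entry the slack in `u` and `v` is 4 n + 6 v - 4 u, so `u ≤ v` matters;
  -- substituting `u + p` for `v` makes all coefficients nonnegative. The other case is treated in
  -- the same way with `v + p` for `u`.
  ...   | inj₁ u≤v with ℕ.m≤n⇒∃[o]m+o≡n u≤v
  ...     | p , refl = inj₁ (drop-by _ (γ + + (u ℕ.+ p) + + u) (γ + + (u ℕ.+ p)) γ 2 6 14 10 u p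
          (h⁺ γ (+ u) (+ p)) (h⁻ γ (+ u) (+ p)))
    where
    h⁺ : ∀ γ u p →
      (+ 1 + + 2 * (γ + (u + p) + u)) + (+ 1 + + 2 * (γ + (u + p))) + (+ 1 + + 2 * γ) ≡
      + 8 * (γ - (γ + (u + p))) + (+ 1 + + 2 * (γ + (u + p) + u)) + + 2 + (+ 4 * (γ + (u + p) + u) + + 2 * u + + 6 * p)
    h⁺ = solve-∀
    h⁻ : ∀ γ u p →
      - ((+ 1 + + 2 * (γ + (u + p) + u)) + (+ 1 + + 2 * (γ + (u + p))) + (+ 1 + + 2 * γ)) ≡
      + 8 * (γ - (γ + (u + p))) + - (+ 1 + + 2 * (γ + (u + p) + u)) + + 2 + (+ 4 * (- (+ 1 + (γ + (u + p) + u))) + + 14 * u + + 10 * p)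
    h⁻ = solve-∀
  drop-max α β γ β≤α γ≤α | inj₁ γ≤β | v , refl | u , refl | inj₂ v≤u with ℕ.m≤n⇒∃[o]m+o≡n v≤u
  ...     | p , refl = inj₂ (drop-by _ γ (γ + + v + + (v ℕ.+ p)) (γ + + v) 14 10 2 6 v p
          (h⁺ γ (+ v) (+ p)) (h⁻ γ (+ v) (+ p)))
    where
    h⁺ : ∀ γ v p →
      (+ 1 + + 2 * (γ + v + (v + p))) + (+ 1 + + 2 * (γ + v)) + (+ 1 + + 2 * γ) ≡
      + 8 * (γ + v - (γ + v + (v + p))) + (+ 1 + + 2 * γ) + + 2 + (+ 4 * γ + + 14 * v + + 10 * p)
    h⁺ = solve-∀
    h⁻ : ∀ γ v p →
      - ((+ 1 + + 2 * (γ + v + (v + p))) + (+ 1 + + 2 * (γ + v)) + (+ 1 + + 2 * γ)) ≡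
      + 8 * (γ + v - (γ + v + (v + p))) + - (+ 1 + + 2 * γ) + + 2 + (+ 4 * (- (+ 1 + γ)) + + 2 * v + + 6 * p)
    h⁻ = solve-∀

  rotate : ∀ i j k → i + j + k ≡ j + k + i
  rotate i j k = trans (+-assoc i j k) (+-comm i (j + k))

  -- The claim is invariant under cyclic rotation, so the largest of the three can be moved to the
  -- front.
  drop : ∀ α β γ → let T = odd α + odd β + odd γ in Drop T α β γ ⊎ Drop T β γ α ⊎ Drop T γ α β
  drop α β γ with ≤-total β α | ≤-total γ α | ≤-total γ β
  ... | inj₁ β≤α | inj₁ γ≤α | _ = Sum.map₂ inj₂ (drop-max α β γ β≤α γ≤α)
  ... | inj₁ β≤α | inj₂ α≤γ | _ = Sum.[ (λ d → inj₂ (inj₂ (turn d))) , (λ d → inj₂ (inj₁ (turn d))) ]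
          (drop-max γ α β α≤γ (≤-trans β≤α α≤γ))
    where turn = λ {x y z} → subst (λ T → Drop T x y z) (rotate (odd γ) (odd α) (odd β))
  ... | inj₂ α≤β | _ | inj₁ γ≤β = Sum.[ (λ d → inj₂ (inj₁ (turn d))) , (λ d → inj₁ (turn d)) ]
          (drop-max β γ α γ≤β α≤β)
    where turn = λ {x y z} → subst (λ T → Drop T x y z) (sym (rotate (odd α) (odd β) (odd γ)))
  ... | inj₂ α≤β | _ | inj₂ β≤γ = Sum.[ (λ d → inj₂ (inj₂ (turn d))) , (λ d → inj₂ (inj₁ (turn d))) ]
          (drop-max γ α β (≤-trans α≤β β≤γ) β≤γ)
    where turn = λ {x y z} → subst (λ T → Drop T x y z) (rotate (odd γ) (odd α) (odd β))

open Drops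

-- Three prefixes, one in each order, with a small total χ-sum.

module Discrepancy where

  open import Data.Integer.Base using (+_; _+_; _-_; _*_; -_; _≤_; ∣_∣; +≤+)
  open import Data.Integer.Properties
  open ℤ-Solver using (solve-∀)

  -- The total of χ is twice the weight of `w` minus 3^k, where 3^k = 1 + 2 `half k`. The shift by
  -- `suc (half k)` makes this total the `odd` of the excess.
  excess : ∀ k → (Word k → ℕ) → ℤ
  excess k w = + ∑ (words k) w - + suc (half k)

  -- The total of the colouring χ v = 2 w v − 1.
  balance : ∀ k → (Word k → ℕ) → ℤ
  balance k w = odd (excess k w)

  -- Since the first e elements in the order t have χ-sum 2 pre − e, this bounds
  -- 8 times the sum of three such prefixes, one in each order.
  record LowPrefixes (k : ℕ) (w : Word k → ℕ) : Set where
    constructor low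
    field
      e     : Fin 3 → ℕ
      e≤    : ∀ t → e t ℕ.≤ 3 ℕ.^ k
      bound : + 16 * + sum₃ (λ t → pre k t (e t) w) + + 2 * + k ≤
              + 12 * balance k w + + ∣ balance k w ∣ + + 8 * + sum₃ e

  next : Fin 3 → Fin 3
  next 0F = 1F
  next 1F = 2F
  next 2F = 0F

  -- In the three cyclic orders `d` comes first, second and third. It is thus preceded by nothing,
  -- by its cyclic predecessor `next (next d)`, and by both other letters.
  before-sum : ∀ d W → sum₃ (λ t → before t d W) ≡ W (next d) ℕ.+ 2 ℕ.* W (next (next d))
  before-sum 0F W = lemma (W 1F) (W 2F)
    where
    lemma : ∀ x y → y ℕ.+ (x ℕ.+ y) ≡ x ℕ.+ 2 ℕ.* y
    lemma = ℕ-Solver.solve-∀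
  before-sum 1F W = lemma (W 2F) (W 0F)
    where
    lemma : ∀ x y → y ℕ.+ (x ℕ.+ y) ℕ.+ 0 ≡ x ℕ.+ 2 ℕ.* y
    lemma = ℕ-Solver.solve-∀
  before-sum 2F W = lemma (W 0F) (W 1F)
    where
    lemma : ∀ x y → x ℕ.+ y ℕ.+ 0 ℕ.+ y ≡ x ℕ.+ 2 ℕ.* y
    lemma = ℕ-Solver.solve-∀

  rank-sum : ∀ d N e → sum₃ (λ t → rank t d ℕ.* N ℕ.+ e t) ≡ 3 ℕ.* N ℕ.+ sum₃ e
  rank-sum 0F N e = lemma N (e 0F) (e 1F) (e 2F)
    where
    lemma : ∀ N x y z → x ℕ.+ (1 ℕ.* N ℕ.+ y) ℕ.+ (2 ℕ.* N ℕ.+ z) ≡ 3 ℕ.* N ℕ.+ (x ℕ.+ y ℕ.+ z)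
    lemma = ℕ-Solver.solve-∀
  rank-sum 1F N e = lemma N (e 0F) (e 1F) (e 2F)
    where
    lemma : ∀ N x y z → 1 ℕ.* N ℕ.+ x ℕ.+ (2 ℕ.* N ℕ.+ y) ℕ.+ z ≡ 3 ℕ.* N ℕ.+ (x ℕ.+ y ℕ.+ z)
    lemma = ℕ-Solver.solve-∀
  rank-sum 2F N e = lemma N (e 0F) (e 1F) (e 2F)
    where
    lemma : ∀ N x y z → 2 ℕ.* N ℕ.+ x ℕ.+ y ℕ.+ (1 ℕ.* N ℕ.+ z) ≡ 3 ℕ.* N ℕ.+ (x ℕ.+ y ℕ.+ z)
    lemma = ℕ-Solver.solve-∀

  module _ (k : ℕ) (w : Word (suc k) → ℕ) where

    part : Fin 3 → Word k → ℕ
    part d v = w (d ∷ v)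

    private
      W : Fin 3 → ℕ
      W d = ∑ (words k) (part d)

      α : Fin 3 → ℤ
      α d = excess k (part d)

    balance-suc : balance (suc k) w ≡ odd (α 0F) + odd (α 1F) + odd (α 2F)
    balance-suc = trans
      (cong₂ (λ x y → odd (x - y))
        (cong +_ (∑-words k w))
        (trans (pos-+ 2 (3 ℕ.* half k)) (cong (λ h → + 2 + h) (pos-* 3 (half k)))))
      (lemma (+ W 0F) (+ W 1F) (+ W 2F) (+ half k))
      where
      lemma : ∀ a b c h → + 1 + + 2 * (a + (b + c) - (+ 2 + + 3 * h)) ≡
        (+ 1 + + 2 * (a - (+ 1 + h))) + (+ 1 + + 2 * (b - (+ 1 + h))) + (+ 1 + + 2 * (c - (+ 1 + h)))
      lemma = solve-∀

    -- Let b and c be the χ-sums of the blocks of `next d` and `next (next d)`. The new prefixes add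
    -- 8 (b + 2 c) = 12 (b + c) + 4 (c - b) to the left side. The growth of 12 T pays for the first
    -- term; `Drop` pays for the second, for the change of the absolute value and for the 2 of the
    -- new level.
    extend : ∀ d → balance (suc k) w ≡ odd (α d) + odd (α (next d)) + odd (α (next (next d))) →
      Drop (balance (suc k) w) (α d) (α (next d)) (α (next (next d))) →
      LowPrefixes k (part d) → LowPrefixes (suc k) w
    extend d balance≡ (dropped drop≤) (low e e≤ ih) = low e′ e′≤ (begin
      + 16 * + sum₃ (λ t → pre (suc k) t (e′ t) w) + + 2 * + suc k
        ≤⟨ +-monoˡ-≤ (+ 2 * + suc k) (*-monoˡ-≤-nonNeg (+ 16) (+≤+ P≤)) ⟩
      + 16 * + (W b ℕ.+ 2 ℕ.* W c ℕ.+ P) + + 2 * + suc k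
        ≡⟨ cong (λ x → + 16 * (+ W b + x + + P) + + 2 * + suc k) (pos-* 2 (W c)) ⟩
      + 16 * (+ W b + + 2 * + W c + + P) + + 2 * (+ 1 + + k)
        ≡⟨ lhs (+ W b) (+ W c) (+ P) (+ k) (+ half k) (+ ∣ odd (α d) ∣) ⟩
      + 16 * + P + + 2 * + k + (+ 8 * (α c - α b) + + ∣ odd (α d) ∣ + + 2) + X
        ≤⟨ +-monoˡ-≤ X (+-mono-≤ ih drop≤) ⟩
      + 12 * odd (α d) + + ∣ odd (α d) ∣ + + 8 * + sum₃ e + + ∣ T ∣ + X
        ≡⟨ rhs (α d) (+ W b) (+ W c) (+ half k) (+ ∣ odd (α d) ∣) (+ sum₃ e) (+ ∣ T ∣) ⟩
      + 12 * (odd (α d) + odd (α b) + odd (α c)) + + ∣ T ∣ + + 8 * (+ 3 * (+ 1 + + 2 * + half k) + + sum₃ e)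
        ≡⟨ cong₂ (λ x y → + 12 * x + + ∣ T ∣ + + 8 * y) (sym balance≡) (sym e-sum) ⟩
      + 12 * T + + ∣ T ∣ + + 8 * + sum₃ e′ ∎)
      where
      open ≤-Reasoning
      N P : ℕ
      N = 3 ℕ.^ k
      P = sum₃ (λ t → pre k t (e t) (part d))

      b c : Fin 3
      b = next d
      c = next (next d)

      T X : ℤ
      T = balance (suc k) w
      -- A block weighs `suc (half k)` more than its excess, so the bracket equals `W b + 2 W c`.
      -- Thus `X` is what remains of the left side once the induction hypothesis and `Drop` are
      -- split off.
      X = + 16 * (α b + + 2 * α c + + 3 + + 3 * + half k) - + 8 * (α c - α b) - + ∣ odd (α d) ∣

      e′ : Fin 3 → ℕ
      e′ t = rank t d ℕ.* N ℕ.+ e t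

      e′≤ : ∀ t → e′ t ℕ.≤ 3 ℕ.^ suc k
      e′≤ t = ℕ.≤-trans (ℕ.+-mono-≤ (ℕ.*-monoˡ-≤ N (rank≤2 t d)) (e≤ t)) (ℕ.≤-reflexive (ℕ.+-comm (2 ℕ.* N) N))

      P≤ : sum₃ (λ t → pre (suc k) t (e′ t) w) ℕ.≤ W b ℕ.+ 2 ℕ.* W c ℕ.+ P
      P≤ = ℕ.≤-trans
        (ℕ.+-mono-≤ (ℕ.+-mono-≤ (pre-block k 0F d (e 0F) w (e≤ 0F)) (pre-block k 1F d (e 1F) w (e≤ 1F)))
          (pre-block k 2F d (e 2F) w (e≤ 2F)))
        (ℕ.≤-reflexive (trans
          (interchange (before 0F d W) (before 1F d W) (before 2F d W)
            (pre k 0F (e 0F) (part d)) (pre k 1F (e 1F) (part d)) (pre k 2F (e 2F) (part d)))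
          (cong (ℕ._+ P) (before-sum d W))))
        where
        interchange : ∀ a b c x y z →
          a ℕ.+ x ℕ.+ (b ℕ.+ y) ℕ.+ (c ℕ.+ z) ≡ a ℕ.+ b ℕ.+ c ℕ.+ (x ℕ.+ y ℕ.+ z)
        interchange = ℕ-Solver.solve-∀

      e-sum : + sum₃ e′ ≡ + 3 * (+ 1 + + 2 * + half k) + + sum₃ e
      e-sum = trans (cong +_ (rank-sum d N e)) (cong (λ x → x + + sum₃ e) (trans (pos-* 3 N)
        (cong (λ x → + 3 * x) (trans (cong +_ (3^k≡1+2half k)) (cong (λ x → + 1 + x) (pos-* 2 (half k)))))))

      lhs : ∀ B C P k h x → + 16 * (B + + 2 * C + P) + + 2 * (+ 1 + k) ≡
        + 16 * P + + 2 * k + (+ 8 * (C - (+ 1 + h) - (B - (+ 1 + h))) + x + + 2) +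
        (+ 16 * (B - (+ 1 + h) + + 2 * (C - (+ 1 + h)) + + 3 + + 3 * h) -
          + 8 * (C - (+ 1 + h) - (B - (+ 1 + h))) - x)
      lhs = solve-∀

      rhs : ∀ a B C h x E t →
        + 12 * (+ 1 + + 2 * a) + x + + 8 * E + t +
        (+ 16 * (B - (+ 1 + h) + + 2 * (C - (+ 1 + h)) + + 3 + + 3 * h) -
          + 8 * (C - (+ 1 + h) - (B - (+ 1 + h))) - x) ≡
        + 12 * ((+ 1 + + 2 * a) + (+ 1 + + 2 * (B - (+ 1 + h))) + (+ 1 + + 2 * (C - (+ 1 + h)))) +
        t + + 8 * (+ 3 * (+ 1 + + 2 * h) + E)
      rhs = solve-∀

    low-prefixes-suc : (∀ d → LowPrefixes k (part d)) → LowPrefixes (suc k) w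
    low-prefixes-suc lows with subst (λ T → Drop T a b c ⊎ Drop T b c a ⊎ Drop T c a b)
                                 (sym balance-suc) (drop a b c)
      where
      a = α 0F
      b = α 1F
      c = α 2F
    ... | inj₁ d        = extend 0F balance-suc d (lows 0F)
    ... | inj₂ (inj₁ d) = extend 1F (trans balance-suc
      (rotate (odd (α 0F)) (odd (α 1F)) (odd (α 2F)))) d (lows 1F)
    ... | inj₂ (inj₂ d) = extend 2F (trans balance-suc
      (sym (rotate (odd (α 2F)) (odd (α 0F)) (odd (α 1F))))) d (lows 2F)

  low-prefixes : ∀ k w → LowPrefixes k w
  low-prefixes zero w with w [] in eq
  -- A string of weight 0 has χ = -1: the full prefixes leave -12 + 1 + 24 on the right. For
  -- positive weight T is positive, and the empty prefixes do.
  ... | zero  = low (λ _ → 1) (λ _ → s≤s z≤n) bound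
    where
    bound : + 16 * + sum₃ (λ t → pre 0 t 1 w) + + 2 * + 0 ≤
            + 12 * balance 0 w + + ∣ balance 0 w ∣ + + 8 * + 3
    bound rewrite eq = +≤+ z≤n
  ... | suc n = low (λ _ → 0) (λ _ → z≤n) bound
    where
    bound : + 0 ≤ + 12 * balance 0 w + + ∣ balance 0 w ∣ + + 0
    bound rewrite eq | sym (pos-* 2 (n ℕ.+ 0)) = +≤+ z≤n
  low-prefixes (suc k) w = low-prefixes-suc k w (λ d → low-prefixes k (part k w d))

open Discrepancy

-- The patterns of the strings, the counting consequence of covering, and the fractional solution.

module Patterns where

  open import Data.Nat.Base using (_+_; _*_; _^_; _≤_; _<_; _⊓_)
  open import Data.Nat.Properties
  open ℕ-Solver using (solve-∀)

  _≟ˢ_ : ∀ {n} (p q : Subset n) → Dec (p ≡ q)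
  _≟ˢ_ = ≡-dec Bool._≟_

  ∑-allFin : ∀ n (f : Fin (suc n) → ℕ) → ∑ (allFin (suc n)) f ≡ f zero + ∑[ i ← allFin n ] f (suc i)
  ∑-allFin n f = cong (f zero +_) (cong sum
    (trans (map-tabulate suc f) (sym (map-tabulate (λ i → i) (f ∘ suc)))))

  allFin-single : ∀ n a → ∑[ i ← allFin n ] 𝟙 (toℕ i ≟ a) ≤ 1
  allFin-single zero    a = z≤n
  allFin-single (suc n) zero = ≤-reflexive (trans (∑-allFin n (λ i → 𝟙 (toℕ i ≟ 0)))
    (cong suc (∑-zero (allFin n) (λ i → 𝟙-no (suc (toℕ i) ≟ 0) (λ ())))))
  allFin-single (suc n) (suc a) = begin
    ∑[ i ← allFin (suc n) ] 𝟙 (toℕ i ≟ suc a)      ≡⟨ ∑-allFin n (λ i → 𝟙 (toℕ i ≟ suc a)) ⟩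
    ∑[ i ← allFin n ] 𝟙 (suc (toℕ i) ≟ suc a)      ≤⟨ ∑-mono (allFin n) (λ i →
                                                         𝟙-mono (suc (toℕ i) ≟ suc a) (toℕ i ≟ a) suc-injective) ⟩
    ∑[ i ← allFin n ] 𝟙 (toℕ i ≟ a)                ≤⟨ allFin-single n a ⟩
    1                                              ∎
    where open ≤-Reasoning

  allFin-below : ∀ n m → m ≤ n → m ≤ ∑[ i ← allFin n ] 𝟙 (toℕ i <? m)
  allFin-below n       zero    _          = z≤n
  allFin-below (suc n) (suc m) (s≤s m≤n) = begin
    suc m                                          ≤⟨ s≤s (allFin-below n m m≤n) ⟩
    suc (∑[ i ← allFin n ] 𝟙 (toℕ i <? m))         ≤⟨ s≤s (∑-mono (allFin n) (λ i →
                                                         𝟙-mono (toℕ i <? m) (suc (toℕ i) <? suc m) s≤s)) ⟩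
    suc (∑[ i ← allFin n ] 𝟙 (suc (toℕ i) <? suc m)) ≡⟨ sym (∑-allFin n (λ i → 𝟙 (toℕ i <? suc m))) ⟩
    ∑[ i ← allFin (suc n) ] 𝟙 (toℕ i <? suc m)     ∎
    where open ≤-Reasoning

  -- This expresses that `allSubsets n` lists every subset exactly once.
  ∑-single : ∀ n (p₀ : Subset n) (g : Subset n → ℕ) → ∑[ p ← allSubsets n ] (𝟙 (p ≟ˢ p₀) * g p) ≡ g p₀
  ∑-single zero    []        g = trans (+-identityʳ _) (*-identityˡ (g []))
  ∑-single (suc n) (b ∷ p₀) g = trans
    (trans (∑-++ (map (outside ∷_) (allSubsets n)) _ f)
      (cong₂ _+_ (∑-map (outside ∷_) (allSubsets n) f) (∑-map (inside ∷_) (allSubsets n) f)))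
    (go b)
    where
    f : Subset (suc n) → ℕ
    f p = 𝟙 (p ≟ˢ (b ∷ p₀)) * g p

    𝟙-∷ : ∀ c p → 𝟙 ((c ∷ p) ≟ˢ (c ∷ p₀)) ≡ 𝟙 (p ≟ˢ p₀)
    𝟙-∷ c p = ≤-antisym (𝟙-mono ((c ∷ p) ≟ˢ (c ∷ p₀)) (p ≟ˢ p₀) ∷-injectiveʳ)
                        (𝟙-mono (p ≟ˢ p₀) ((c ∷ p) ≟ˢ (c ∷ p₀)) (cong (c ∷_)))

    same : ∀ c → ∑[ p ← allSubsets n ] (𝟙 ((c ∷ p) ≟ˢ (c ∷ p₀)) * g (c ∷ p)) ≡ g (c ∷ p₀)
    same c = trans (∑-cong (allSubsets n) (λ p → cong (_* g (c ∷ p)) (𝟙-∷ c p)))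
      (∑-single n p₀ (g ∘ (c ∷_)))

    other : ∀ c d → c ≢ d → ∑[ p ← allSubsets n ] (𝟙 ((c ∷ p) ≟ˢ (d ∷ p₀)) * g (c ∷ p)) ≡ 0
    other c d c≢d = ∑-zero (allSubsets n) (λ p → cong (_* g (c ∷ p))
      (𝟙-no ((c ∷ p) ≟ˢ (d ∷ p₀)) (c≢d ∘ ∷-injectiveˡ)))

    go : ∀ b → ∑[ p ← allSubsets n ] (𝟙 ((outside ∷ p) ≟ˢ (b ∷ p₀)) * g (outside ∷ p)) +
               ∑[ p ← allSubsets n ] (𝟙 ((inside ∷ p) ≟ˢ (b ∷ p₀)) * g (inside ∷ p)) ≡ g (b ∷ p₀)
    go outside = trans (cong₂ _+_ (same outside) (other inside outside (λ ()))) (+-identityʳ _)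
    go inside  = cong₂ _+_ (other outside inside (λ ())) (same inside)

  ∑-containing : ∀ {n} (i : Fin n) f →
    ∑ (containing i) f ≡ ∑[ p ← allSubsets n ] (𝟙 (i ∈? p) * f p)
  ∑-containing {n} i f = ∑-filter (i ∈?_) (allSubsets n) f

  below : ∀ {n} → ℕ → Subset n → ℕ
  below {n} m p = ∑[ i ← allFin n ] (𝟙 (toℕ i <? m) * 𝟙 (i ∈? p))

  size : ∀ {n} → Subset n → ℕ
  size {n} p = length (filter (_∈? p) (allFin n))

  -- Since σ does not increase indices, the items below m are covered by slots below m.
  covers-below : ∀ {n} (x : Subset n → ℕ) (D : Subset n) → Covers x D → ∀ m → m ≤ n →
    m ≤ size D + ∑[ p ← allSubsets n ] (x p * below m p)
  covers-below {n} x D (σ , σ≤ , covers) m m≤n = begin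
    m
      ≤⟨ allFin-below n m m≤n ⟩
    ∑[ j ← allFin n ] 𝟙 (toℕ j <? m)
      ≤⟨ ∑-mono (allFin n) pointwise ⟩
    ∑[ j ← allFin n ] (𝟙 (j ∈? D) + ∑[ i ← allFin n ] (𝟙 (toℕ i <? m) * 𝟙 (sent? i j)))
      ≡⟨ ∑-+ (allFin n) _ _ ⟩
    ∑[ j ← allFin n ] 𝟙 (j ∈? D) + ∑[ j ← allFin n ] ∑[ i ← allFin n ] (𝟙 (toℕ i <? m) * 𝟙 (sent? i j))
      ≡⟨ cong₂ _+_ (sym (length-filter (_∈? D) (allFin n)))
           (∑-swap (allFin n) (allFin n) (λ j i → 𝟙 (toℕ i <? m) * 𝟙 (sent? i j))) ⟩
    size D + ∑[ i ← allFin n ] ∑[ j ← allFin n ] (𝟙 (toℕ i <? m) * 𝟙 (sent? i j))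
      ≤⟨ +-monoʳ-≤ (size D) (∑-mono (allFin n) slots) ⟩
    size D + ∑[ i ← allFin n ] ∑[ p ← allSubsets n ] (x p * (𝟙 (toℕ i <? m) * 𝟙 (i ∈? p)))
      ≡⟨ cong (size D +_) (∑-swap (allFin n) (allSubsets n) (λ i p → x p * (𝟙 (toℕ i <? m) * 𝟙 (i ∈? p)))) ⟩
    size D + ∑[ p ← allSubsets n ] ∑[ i ← allFin n ] (x p * (𝟙 (toℕ i <? m) * 𝟙 (i ∈? p)))
      ≡⟨ cong (size D +_) (∑-cong (allSubsets n) (λ p → ∑-*ˡ (allFin n) (x p) _)) ⟩
    size D + ∑[ p ← allSubsets n ] (x p * below m p) ∎
    where
    open ≤-Reasoning

    sent? : ∀ i j → Dec ((j ∉ D) × σ j ≡ i)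
    sent? i j = ¬? (j ∈? D) ×-dec (σ j Fin.≟ i)

    pointwise : ∀ j → 𝟙 (toℕ j <? m) ≤ 𝟙 (j ∈? D) + ∑[ i ← allFin n ] (𝟙 (toℕ i <? m) * 𝟙 (sent? i j))
    pointwise j with toℕ j <? m | j ∈? D
    ... | no _    | _       = z≤n
    ... | yes _   | yes _   = s≤s z≤n
    ... | yes j<m | no  j∉D = ≤-trans
      (≤-reflexive (sym (cong₂ _*_ (𝟙-yes (toℕ (σ j) <? m) (≤-<-trans (σ≤ j j∉D) j<m))
        (𝟙-yes (¬? (no j∉D) ×-dec (σ j Fin.≟ σ j)) (j∉D , refl)))))
      (∑-∈ (λ i → 𝟙 (toℕ i <? m) * 𝟙 (¬? (no j∉D) ×-dec (σ j Fin.≟ i))) (∈-allFin (σ j)))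

    slots : ∀ i → ∑[ j ← allFin n ] (𝟙 (toℕ i <? m) * 𝟙 (sent? i j)) ≤
                  ∑[ p ← allSubsets n ] (x p * (𝟙 (toℕ i <? m) * 𝟙 (i ∈? p)))
    slots i = begin
      ∑[ j ← allFin n ] (𝟙 (toℕ i <? m) * 𝟙 (sent? i j))
        ≡⟨ ∑-*ˡ (allFin n) (𝟙 (toℕ i <? m)) _ ⟩
      𝟙 (toℕ i <? m) * ∑[ j ← allFin n ] 𝟙 (sent? i j)
        ≡⟨ cong (𝟙 (toℕ i <? m) *_) (sym (length-filter (sent? i) (allFin n))) ⟩
      𝟙 (toℕ i <? m) * preimageSize D σ i
        ≤⟨ *-monoʳ-≤ (𝟙 (toℕ i <? m)) (covers i) ⟩
      𝟙 (toℕ i <? m) * ∑ (containing i) x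
        ≡⟨ cong (𝟙 (toℕ i <? m) *_) (∑-containing i x) ⟩
      𝟙 (toℕ i <? m) * ∑[ p ← allSubsets n ] (𝟙 (i ∈? p) * x p)
        ≡⟨ sym (∑-*ˡ (allSubsets n) (𝟙 (toℕ i <? m)) _) ⟩
      ∑[ p ← allSubsets n ] (𝟙 (toℕ i <? m) * (𝟙 (i ∈? p) * x p))
        ≡⟨ ∑-cong (allSubsets n) (λ p → lemma (𝟙 (toℕ i <? m)) (𝟙 (i ∈? p)) (x p)) ⟩
      ∑[ p ← allSubsets n ] (x p * (𝟙 (toℕ i <? m) * 𝟙 (i ∈? p))) ∎
      where
      lemma : ∀ a b c → a * (b * c) ≡ c * (a * b)
      lemma = solve-∀

  -- The multiplicities x are handed out to the strings; x′ is what is left of x.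
  record Assignment {n} (k : ℕ) (pat : Word k → Subset n) (x : Subset n → ℕ) : Set where
    field
      w        : Word k → ℕ
      x′       : Subset n → ℕ
      split    : ∀ (f : Subset n → ℕ) → ∑[ p ← allSubsets n ] (x p * f p) ≡
                       ∑[ v ← words k ] (w v * f (pat v)) + ∑[ p ← allSubsets n ] (x′ p * f p)
      vanish   : ∀ p → x p ≡ 0 → x′ p ≡ 0
      used-up  : ∀ v → x′ (pat v) ≡ 0

  -- The strings are served in lexicographic order, and each takes all that is left of its pattern.
  -- So nothing is counted twice when strings share a pattern.
  assign : ∀ {n} k (pat : Word k → Subset n) x → Assignment k pat x
  assign {n} zero pat x = record
    { w       = λ _ → x p₀
    ; x′      = x′
    ; split   = λ f → begin
        ∑[ p ← allSubsets n ] (x p * f p)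
          ≡⟨ ∑-cong (allSubsets n) (λ p → pointwise f p) ⟩
        ∑[ p ← allSubsets n ] (𝟙 (p ≟ˢ p₀) * (x p * f p) + x′ p * f p)
          ≡⟨ ∑-+ (allSubsets n) _ _ ⟩
        ∑[ p ← allSubsets n ] (𝟙 (p ≟ˢ p₀) * (x p * f p)) + ∑[ p ← allSubsets n ] (x′ p * f p)
          ≡⟨ cong (_+ ∑[ p ← allSubsets n ] (x′ p * f p)) (trans (∑-single n p₀ (λ p → x p * f p)) (sym (+-identityʳ _))) ⟩
        x p₀ * f p₀ + 0 + ∑[ p ← allSubsets n ] (x′ p * f p) ∎
    ; vanish  = vanish
    ; used-up = λ { [] → used-up }
    }
    where
    open ≡-Reasoning
    p₀ : Subset n
    p₀ = pat []

    x′ : Subset n → ℕ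
    x′ p = case p ≟ˢ p₀ of λ { (yes _) → 0 ; (no _) → x p }

    pointwise : ∀ (f : Subset n → ℕ) p → x p * f p ≡ 𝟙 (p ≟ˢ p₀) * (x p * f p) + x′ p * f p
    pointwise f p with p ≟ˢ p₀
    ... | yes _ = lemma (x p * f p)
      where
      lemma : ∀ a → a ≡ 1 * a + 0
      lemma = solve-∀
    ... | no _  = refl

    vanish : ∀ p → x p ≡ 0 → x′ p ≡ 0
    vanish p eq with p ≟ˢ p₀
    ... | yes _ = refl
    ... | no _  = eq

    used-up : x′ p₀ ≡ 0
    used-up with p₀ ≟ˢ p₀
    ... | yes _ = refl
    ... | no ≢  = ⊥-elim (≢ refl)
  assign {n} (suc k) pat x = record
    { w       = w
    ; x′      = A₂.x′
    ; split   = split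
    ; vanish  = λ p → A₂.vanish p ∘ A₁.vanish p ∘ A₀.vanish p
    ; used-up = used-up
    }
    where
    module A₀ = Assignment (assign k (pat ∘ (0F ∷_)) x)
    module A₁ = Assignment (assign k (pat ∘ (1F ∷_)) A₀.x′)
    module A₂ = Assignment (assign k (pat ∘ (2F ∷_)) A₁.x′)

    w : Word (suc k) → ℕ
    w (0F ∷ v) = A₀.w v
    w (1F ∷ v) = A₁.w v
    w (2F ∷ v) = A₂.w v

    split : ∀ (f : Subset n → ℕ) → ∑[ p ← allSubsets n ] (x p * f p) ≡
      ∑[ v ← words (suc k) ] (w v * f (pat v)) + ∑[ p ← allSubsets n ] (A₂.x′ p * f p)
    split f = begin
      ∑[ p ← allSubsets n ] (x p * f p)   ≡⟨ A₀.split f ⟩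
      S 0F + _                            ≡⟨ cong (S 0F +_) (A₁.split f) ⟩
      S 0F + (S 1F + _)                   ≡⟨ cong (λ s → S 0F + (S 1F + s)) (A₂.split f) ⟩
      S 0F + (S 1F + (S 2F + rest))       ≡⟨ assoc (S 0F) (S 1F) (S 2F) rest ⟩
      S 0F + (S 1F + S 2F) + rest         ≡⟨ cong (_+ rest) (sym (∑-words k (λ v → w v * f (pat v)))) ⟩
      ∑[ v ← words (suc k) ] (w v * f (pat v)) + rest ∎
      where
      open ≡-Reasoning
      S : Fin 3 → ℕ
      S d = ∑[ v ← words k ] (w (d ∷ v) * f (pat (d ∷ v)))
      rest : ℕ
      rest = ∑[ p ← allSubsets n ] (A₂.x′ p * f p)
      assoc : ∀ a b c d → a + (b + (c + d)) ≡ a + (b + c) + d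
      assoc = solve-∀

    used-up : ∀ v → A₂.x′ (pat v) ≡ 0
    used-up (0F ∷ v) = A₂.vanish _ (A₁.vanish _ (A₀.used-up v))
    used-up (1F ∷ v) = A₂.vanish _ (A₁.used-up v)
    used-up (2F ∷ v) = A₂.used-up v

  ≤1+2⌊n/2⌋ : ∀ n → n ≤ 1 + 2 * ⌊ n /2⌋
  ≤1+2⌊n/2⌋ 0             = z≤n
  ≤1+2⌊n/2⌋ 1             = s≤s z≤n
  ≤1+2⌊n/2⌋ (suc (suc n)) = ≤-trans (s≤s (s≤s (≤1+2⌊n/2⌋ n))) (≤-reflexive (lemma ⌊ n /2⌋))
    where
    lemma : ∀ h → suc (suc (1 + 2 * h)) ≡ 1 + 2 * suc h
    lemma = solve-∀

  ⌊2*n/2⌋ : ∀ n → ⌊ 2 * n /2⌋ ≡ n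
  ⌊2*n/2⌋ n = trans (cong (λ m → ⌊ n + m /2⌋) (+-identityʳ n)) (sym (n≡⌊n+n/2⌋ n))

  ⌊1+2*n/2⌋ : ∀ n → ⌊ 1 + 2 * n /2⌋ ≡ n
  ⌊1+2*n/2⌋ zero    = refl
  ⌊1+2*n/2⌋ (suc n) = trans (cong ⌊_/2⌋ (cong suc (*-suc 2 n))) (cong suc (⌊1+2*n/2⌋ n))

  items : ℕ → ℕ
  items k = 3 * half k

  -- Items come in three groups of half k; in group t consecutive positions of the
  -- order t share an item. The last position falls outside the group.
  slot : ∀ {k} → Fin 3 → Word k → ℕ
  slot {k} t v = toℕ t * half k + ⌊ pos t v /2⌋

  from-does : ∀ {P : Set} (P? : Dec P) → does P? ≡ true → P
  from-does (yes p) _ = p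

  module _ {k : ℕ} where

    private
      N M n : ℕ
      N = 3 ^ k
      M = half k
      n = items k

    hit? : ∀ (v : Word k) (i : Fin n) → Dec (∃[ t ] toℕ i ≡ slot t v)
    hit? v i = Fin.any? (λ t → toℕ i ≟ slot t v)

    packing : Word k → Subset n
    packing v = tabulate (λ i → does (hit? v i))

    slot⇒∈ : ∀ v i t → toℕ i ≡ slot t v → i ∈ packing v
    slot⇒∈ v i t eq = lookup⇒[]= i (packing v)
      (trans (lookup∘tabulate (λ i → does (hit? v i)) i) (dec-true (hit? v i) (t , eq)))

    ∈⇒slot : ∀ v i → i ∈ packing v → ∃[ t ] toℕ i ≡ slot t v
    ∈⇒slot v i i∈ = from-does (hit? v i)
      (trans (sym (lookup∘tabulate (λ i → does (hit? v i)) i)) ([]=⇒lookup i∈))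

    -- Slots of one string may coincide, so this is an inequality: for positive `k` the string of
    -- all 2s is last in the first order and first in the second, which gives the same slot twice.
    𝟙-pattern : ∀ v i → 𝟙 (i ∈? packing v) ≤ sum₃ (λ t → 𝟙 (toℕ i ≟ slot t v))
    𝟙-pattern v i with i ∈? packing v
    ... | no _ = z≤n
    ... | yes i∈ with ∈⇒slot v i i∈
    ...   | 0F , eq = ≤-trans (≤-reflexive (sym (𝟙-yes (toℕ i ≟ slot 0F v) eq))) (≤-trans (m≤m+n _ _) (m≤m+n _ _))
    ...   | 1F , eq = ≤-trans (≤-reflexive (sym (𝟙-yes (toℕ i ≟ slot 1F v) eq))) (≤-trans (m≤n+m _ (𝟙 (toℕ i ≟ slot 0F v))) (m≤m+n _ _))
    ...   | 2F , eq = ≤-trans (≤-reflexive (sym (𝟙-yes (toℕ i ≟ slot 2F v) eq))) (m≤n+m _ (𝟙 (toℕ i ≟ slot 0F v) + 𝟙 (toℕ i ≟ slot 1F v)))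

    below-pattern : ∀ m v → below m (packing v) ≤ sum₃ (λ t → 𝟙 (slot t v <? m))
    below-pattern m v = begin
      ∑[ i ← allFin n ] (𝟙 (toℕ i <? m) * 𝟙 (i ∈? packing v))
        ≤⟨ ∑-mono (allFin n) (λ i → *-monoʳ-≤ (𝟙 (toℕ i <? m)) (𝟙-pattern v i)) ⟩
      ∑[ i ← allFin n ] (𝟙 (toℕ i <? m) * sum₃ (λ t → 𝟙 (toℕ i ≟ slot t v)))
        ≤⟨ ∑-mono (allFin n) (λ i → ≤-trans
             (≤-reflexive (distrib (𝟙 (toℕ i <? m)) (𝟙 (toℕ i ≟ slot 0F v)) _ _))
             (+-mono-≤ (+-mono-≤ (move i 0F) (move i 1F)) (move i 2F))) ⟩
      ∑[ i ← allFin n ] sum₃ (λ t → 𝟙 (slot t v <? m) * 𝟙 (toℕ i ≟ slot t v))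
        ≡⟨ ∑-sum₃ (allFin n) (λ i t → 𝟙 (slot t v <? m) * 𝟙 (toℕ i ≟ slot t v)) ⟩
      sum₃ (λ t → ∑[ i ← allFin n ] (𝟙 (slot t v <? m) * 𝟙 (toℕ i ≟ slot t v)))
        ≤⟨ +-mono-≤ (+-mono-≤ (single 0F) (single 1F)) (single 2F) ⟩
      sum₃ (λ t → 𝟙 (slot t v <? m)) ∎
      where
      open ≤-Reasoning
      distrib : ∀ a x y z → a * (x + y + z) ≡ a * x + a * y + a * z
      distrib = solve-∀

      move : ∀ i t → 𝟙 (toℕ i <? m) * 𝟙 (toℕ i ≟ slot t v) ≤ 𝟙 (slot t v <? m) * 𝟙 (toℕ i ≟ slot t v)
      move i t with toℕ i ≟ slot t v
      ... | yes eq = *-monoˡ-≤ 1 (𝟙-mono (toℕ i <? m) (slot t v <? m) (subst (_< m) eq))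
      ... | no _   = ≤-reflexive (trans (*-zeroʳ (𝟙 (toℕ i <? m))) (sym (*-zeroʳ (𝟙 (slot t v <? m)))))

      single : ∀ t → ∑[ i ← allFin n ] (𝟙 (slot t v <? m) * 𝟙 (toℕ i ≟ slot t v)) ≤ 𝟙 (slot t v <? m)
      single t = begin
        ∑[ i ← allFin n ] (𝟙 (slot t v <? m) * 𝟙 (toℕ i ≟ slot t v))
          ≡⟨ ∑-*ˡ (allFin n) (𝟙 (slot t v <? m)) _ ⟩
        𝟙 (slot t v <? m) * ∑[ i ← allFin n ] 𝟙 (toℕ i ≟ slot t v)
          ≤⟨ *-monoʳ-≤ (𝟙 (slot t v <? m)) (allFin-single n (slot t v)) ⟩
        𝟙 (slot t v <? m) * 1
          ≡⟨ *-identityʳ _ ⟩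
        𝟙 (slot t v <? m) ∎

    below≤3 : ∀ m v → below m (packing v) ≤ 3
    below≤3 m v = ≤-trans (below-pattern m v)
      (+-mono-≤ (+-mono-≤ (𝟙≤1 (slot 0F v <? m)) (𝟙≤1 (slot 1F v <? m))) (𝟙≤1 (slot 2F v <? m)))

    size-pattern : ∀ v → size (packing v) ≤ 3
    size-pattern v = begin
      size (packing v)                        ≡⟨ length-filter (_∈? packing v) (allFin n) ⟩
      ∑[ i ← allFin n ] 𝟙 (i ∈? packing v)    ≡⟨ ∑-cong (allFin n) (λ i → sym (trans
                                                    (cong (_* 𝟙 (i ∈? packing v)) (𝟙-yes (toℕ i <? n) (Fin.toℕ<n i)))
                                                    (*-identityˡ _))) ⟩
      below n (packing v)                     ≤⟨ below≤3 n v ⟩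
      3                                        ∎
      where open ≤-Reasoning

    -- In group `t`, a slot below the threshold comes from a position below `e`. Each earlier group
    -- contributes at most one slot, whence `toℕ t`, and the slots of later groups start at or
    -- beyond the threshold because `⌊ e /2⌋ ≤ M`.
    below-group : ∀ t e v → ⌊ e /2⌋ ≤ M →
      below (toℕ t * M + ⌊ e /2⌋) (packing v) ≤ toℕ t + 𝟙 (pos t v <? e)
    below-group t e v q≤M = ≤-trans (below-pattern (toℕ t * M + ⌊ e /2⌋) v) (go t)
      where
      bound : Fin 3 → ℕ
      bound t = toℕ t * M + ⌊ e /2⌋

      any : ∀ t t′ → 𝟙 (slot t′ v <? bound t) ≤ 1
      any t t′ = 𝟙≤1 (slot t′ v <? bound t)

      same : ∀ t → 𝟙 (slot t v <? bound t) ≤ 𝟙 (pos t v <? e)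
      same t = 𝟙-mono (slot t v <? bound t) (pos t v <? e) (λ lt → ≰⇒> (λ e≤ →
        <⇒≱ (+-cancelˡ-< (toℕ t * M) ⌊ pos t v /2⌋ ⌊ e /2⌋ lt) (⌊n/2⌋-mono e≤)))

      after : ∀ t t′ → toℕ t < toℕ t′ → 𝟙 (slot t′ v <? bound t) ≤ 0
      after t t′ t<t′ = ≤-reflexive (𝟙-no (slot t′ v <? bound t) (≤⇒≯ (begin
        toℕ t * M + ⌊ e /2⌋          ≤⟨ +-monoʳ-≤ (toℕ t * M) q≤M ⟩
        toℕ t * M + M                ≡⟨ +-comm (toℕ t * M) M ⟩
        suc (toℕ t) * M              ≤⟨ *-monoˡ-≤ M t<t′ ⟩
        toℕ t′ * M                   ≤⟨ m≤m+n _ ⌊ pos t′ v /2⌋ ⟩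
        toℕ t′ * M + ⌊ pos t′ v /2⌋  ∎)))
        where open ≤-Reasoning

      go : ∀ t → sum₃ (λ t′ → 𝟙 (slot t′ v <? bound t)) ≤ toℕ t + 𝟙 (pos t v <? e)
      go 0F = ≤-trans (+-mono-≤ (+-mono-≤ (same 0F) (after 0F 1F (s≤s z≤n))) (after 0F 2F (s≤s z≤n)))
        (≤-reflexive (trans (+-identityʳ _) (+-identityʳ _)))
      go 1F = ≤-trans (+-mono-≤ (+-mono-≤ (any 1F 0F) (same 1F)) (after 1F 2F (s≤s (s≤s z≤n))))
        (≤-reflexive (+-identityʳ _))
      go 2F = +-mono-≤ (+-mono-≤ (any 2F 0F) (any 2F 1F)) (same 2F)

    multiplicity : Subset n → ℕ
    multiplicity p = ∑[ v ← words k ] 𝟙 (p ≟ˢ packing v)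

    ∑-multiplicity : ∀ f → ∑[ p ← allSubsets n ] (multiplicity p * f p) ≡ ∑[ v ← words k ] f (packing v)
    ∑-multiplicity f = begin
      ∑[ p ← allSubsets n ] (multiplicity p * f p)
        ≡⟨ ∑-cong (allSubsets n) (λ p → sym (∑-*ʳ (words k) (f p) _)) ⟩
      ∑[ p ← allSubsets n ] ∑[ v ← words k ] (𝟙 (p ≟ˢ packing v) * f p)
        ≡⟨ ∑-swap (allSubsets n) (words k) _ ⟩
      ∑[ v ← words k ] ∑[ p ← allSubsets n ] (𝟙 (p ≟ˢ packing v) * f p)
        ≡⟨ ∑-cong (words k) (λ v → ∑-single n (packing v) f) ⟩
      ∑[ v ← words k ] f (packing v) ∎
      where open ≡-Reasoning

    multiplicity-nonzero : ∀ p → multiplicity p ≢ 0 → ∃[ v ] p ≡ packing v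
    multiplicity-nonzero p ≢0 with ∑-nonzero (words k) (λ v → 𝟙 (p ≟ˢ packing v)) ≢0
    ... | v , ≢0′ with p ≟ˢ packing v
    ...   | yes eq = v , eq
    ...   | no _   = ⊥-elim (≢0′ refl)

    -- Twice the fractional solution; truncating at 2 saves us from showing the patterns distinct.
    double-y : Subset n → ℕ
    double-y p = 2 ⊓ multiplicity p

    -- Item `q` of group `t` is shared by the strings at positions 2 q and 2 q + 1 of the order `t`,
    -- which both exist since `q < M`.
    double-y-covers : ∀ i → 2 ≤ ∑ (containing i) double-y
    double-y-covers i with quotient-remainder 3 M (toℕ i) (Fin.toℕ<n i)
    ... | t′ , q , t′<3 , q<M , eq = begin
      2                                                        ≤⟨ ⊓-glb ≤-refl two ⟩
      2 ⊓ ∑ (containing i) multiplicity                        ≤⟨ ∑-⊓ (containing i) 2 multiplicity ⟩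
      ∑ (containing i) double-y                                ∎
      where
      open ≤-Reasoning
      t : Fin 3
      t = Fin.fromℕ< t′<3

      hit : ∀ v → ⌊ pos t v /2⌋ ≡ q → i ∈ packing v
      hit v refl = slot⇒∈ v i t (trans (sym eq) (cong (λ s → s * M + q) (sym (Fin.toℕ-fromℕ< t′<3))))

      at : ∀ e → e < N → 1 ≤ ∑[ v ← words k ] 𝟙 (pos t v ≟ e)
      at e e<N with pos-surjective k t e e<N
      ... | v , pos≡e = ≤-trans (≤-reflexive (sym (𝟙-yes (pos t v ≟ e) pos≡e)))
        (∑-∈ (λ v → 𝟙 (pos t v ≟ e)) (words-complete v))

      split : ∀ v → 𝟙 (pos t v ≟ 2 * q) + 𝟙 (pos t v ≟ 1 + 2 * q) ≤ 𝟙 (i ∈? packing v)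
      split v with pos t v ≟ 2 * q | pos t v ≟ 1 + 2 * q
      ... | yes a | yes b = ⊥-elim (1+n≢n (trans (sym b) a))
      ... | yes a | no _  = ≤-reflexive (sym (𝟙-yes (i ∈? packing v) (hit v (trans (cong ⌊_/2⌋ a) (⌊2*n/2⌋ q)))))
      ... | no _  | yes b = ≤-reflexive (sym (𝟙-yes (i ∈? packing v) (hit v (trans (cong ⌊_/2⌋ b) (⌊1+2*n/2⌋ q)))))
      ... | no _  | no _  = z≤n

      1+2q<N : 1 + 2 * q < N
      1+2q<N = ≤-trans (≤-trans (≤-reflexive (sym (*-suc 2 q))) (*-monoʳ-≤ 2 q<M))
        (≤-trans (n≤1+n (2 * M)) (≤-reflexive (sym (3^k≡1+2half k))))

      two : 2 ≤ ∑ (containing i) multiplicity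
      two = begin
        2
          ≤⟨ +-mono-≤ (at (2 * q) (<-trans (n<1+n _) 1+2q<N)) (at (1 + 2 * q) 1+2q<N) ⟩
        ∑[ v ← words k ] 𝟙 (pos t v ≟ 2 * q) + ∑[ v ← words k ] 𝟙 (pos t v ≟ 1 + 2 * q)
          ≡⟨ sym (∑-+ (words k) _ _) ⟩
        ∑[ v ← words k ] (𝟙 (pos t v ≟ 2 * q) + 𝟙 (pos t v ≟ 1 + 2 * q))
          ≤⟨ ∑-mono (words k) split ⟩
        ∑[ v ← words k ] 𝟙 (i ∈? packing v)
          ≡⟨ sym (∑-multiplicity (λ p → 𝟙 (i ∈? p))) ⟩
        ∑[ p ← allSubsets n ] (multiplicity p * 𝟙 (i ∈? p))
          ≡⟨ ∑-cong (allSubsets n) (λ p → *-comm (multiplicity p) _) ⟩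
        ∑[ p ← allSubsets n ] (𝟙 (i ∈? p) * multiplicity p)
          ≡⟨ sym (∑-containing i multiplicity) ⟩
        ∑ (containing i) multiplicity ∎

    double-y-total : ∑ (allSubsets n) double-y ≤ N
    double-y-total = begin
      ∑ (allSubsets n) double-y                   ≤⟨ ∑-mono (allSubsets n) (λ p → m⊓n≤n 2 (multiplicity p)) ⟩
      ∑ (allSubsets n) multiplicity               ≡⟨ ∑-cong (allSubsets n) (λ p → sym (*-identityʳ _)) ⟩
      ∑[ p ← allSubsets n ] (multiplicity p * 1)  ≡⟨ ∑-multiplicity (λ _ → 1) ⟩
      ∑[ v ← words k ] 1                          ≡⟨ length-words k ⟩
      N                                           ∎
      where open ≤-Reasoning

open Patterns

-- The lower bound on the gap of a rounding, in integers.

module RoundingBound where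

  open import Data.Integer.Base using (+_; 0ℤ; _+_; _-_; _*_; -_; _≤_; ∣_∣; +≤+)
  open import Data.Integer.Properties
  open ℤ-Solver using (solve-∀)

  -- d counts the discarded items, M is the size of a group of items, and P is the
  -- total weight of three prefixes, one in each order, of total length E.
  combine : ∀ k M P E d W → let T = odd (W - (+ 1 + M)) in
    + 16 * P + + 2 * k ≤ + 12 * T + + ∣ T ∣ + + 8 * E →
    + 6 * M + E ≤ + 6 * d + + 6 * W + + 2 * P + + 3 →
    + 3 * M ≤ d + + 3 * W →
    0ℤ ≤ d →
    + 6 * k ≤ + 37 * (+ 6 * W + + 4 * d - + 3 * (+ 1 + + 2 * M)) + + 150
  combine k M P E d W discrepancy prefixes items 0≤d = begin
    + 6 * k
      ≡⟨ lhs k P M E ⟩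
    -- The factors 3 and 24 eliminate `P` and `E`, as 3 · 16 = 24 · 2 and 3 · 8 = 24.
    + 3 * (+ 16 * P + + 2 * k) + + 24 * (+ 6 * M + E) + (- + 48 * P - + 24 * (+ 6 * M + E))
      ≤⟨ +-monoˡ-≤ (- + 48 * P - + 24 * (+ 6 * M + E))
           (+-mono-≤ (*-monoˡ-≤-nonNeg (+ 3) discrepancy) (*-monoˡ-≤-nonNeg (+ 24) prefixes)) ⟩
    + 3 * (+ 12 * T + + ∣ T ∣ + + 8 * E) + + 24 * (+ 6 * d + + 6 * W + + 2 * P + + 3) +
      (- + 48 * P - + 24 * (+ 6 * M + E))
      ≡⟨ mid P M E d W (+ ∣ T ∣) ⟩
    + 3 * + ∣ T ∣ + (+ 36 * G + + 144)
      ≤⟨ +-monoˡ-≤ (+ 36 * G + + 144) 3∣T∣≤ ⟩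
    G + + 6 + (+ 36 * G + + 144)
      ≡⟨ rhs G ⟩
    + 37 * G + + 150 ∎
    where
    open ≤-Reasoning
    T G : ℤ
    T = odd (W - (+ 1 + M))
    -- Six times `W` + 2 `d` / 3 - 3^k / 2: a discarded item of size 1/3 costs 2/3, and 3^k / 2
    -- bounds the fractional value from above.
    G = + 6 * W + + 4 * d - + 3 * (+ 1 + + 2 * M)

    lhs : ∀ k P M E → + 6 * k ≡ + 3 * (+ 16 * P + + 2 * k) + + 24 * (+ 6 * M + E) + (- + 48 * P - + 24 * (+ 6 * M + E))
    lhs = solve-∀

    mid : ∀ P M E d W t →
      + 3 * (+ 12 * (+ 1 + + 2 * (W - (+ 1 + M))) + t + + 8 * E) + + 24 * (+ 6 * d + + 6 * W + + 2 * P + + 3) +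
        (- + 48 * P - + 24 * (+ 6 * M + E)) ≡
      + 3 * t + (+ 36 * (+ 6 * W + + 4 * d - + 3 * (+ 1 + + 2 * M)) + + 144)
    mid = solve-∀

    rhs : ∀ G → G + + 6 + (+ 36 * G + + 144) ≡ + 37 * G + + 150
    rhs = solve-∀

    0≤* : ∀ c {i} → 0ℤ ≤ i → 0ℤ ≤ + c * i
    0≤* c {i} 0≤i = subst (_≤ + c * i) (*-zeroʳ (+ c)) (*-monoˡ-≤-nonNeg (+ c) 0≤i)

    -- Here `G` is 3 T + 4 d, which settles nonnegative T. If T is negative, too few patterns are
    -- used and `items` forces enough discarded items.
    3∣T∣≤ : + 3 * + ∣ T ∣ ≤ G + + 6
    3∣T∣≤ with +∣i∣≡i⊎+∣i∣≡-i T
    ... | inj₁ eq = subst (λ x → + 3 * x ≤ G + + 6) (sym eq)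
      (≤-by (+ 4 * d + + 6) (+-mono-≤ (0≤* 4 0≤d) (+≤+ (z≤n {6}))) (pos-diff W M d))
      where
      pos-diff : ∀ W M d → + 6 * W + + 4 * d - + 3 * (+ 1 + + 2 * M) + + 6 ≡
        + 3 * (+ 1 + + 2 * (W - (+ 1 + M))) + (+ 4 * d + + 6)
      pos-diff = solve-∀
    ... | inj₂ eq = subst (λ x → + 3 * x ≤ G + + 6) (sym eq)
      (≤-by (+ 4 * (d + + 3 * W - + 3 * M)) (0≤* 4 (i≤j⇒0≤j-i items)) (neg-diff W M d))
      where
      neg-diff : ∀ W M d → + 6 * W + + 4 * d - + 3 * (+ 1 + + 2 * M) + + 6 ≡
        + 3 * (- (+ 1 + + 2 * (W - (+ 1 + M)))) + + 4 * (d + + 3 * W - + 3 * M)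
      neg-diff = solve-∀

  module _ {k : ℕ} (x : Subset (items k) → ℕ) (D : Subset (items k))
           (supported : ∀ p → multiplicity {k} p ≡ 0 → x p ≡ 0) (covers : Covers x D) where

    private
      module A = Assignment (assign k packing x)
      open A using (w)

      n M W d : ℕ
      n = items k
      M = half k
      W = ∑ (words k) w
      d = size D

    nothing-left : ∀ p → A.x′ p ≡ 0
    nothing-left p with multiplicity {k} p ℕ.≟ 0
    ... | yes eq = A.vanish p (supported p eq)
    ... | no ≢0 with multiplicity-nonzero {k} p ≢0
    ...   | v , refl = A.used-up v

    x-to-w : ∀ (f : Subset n → ℕ) →
      ∑[ p ← allSubsets n ] (x p ℕ.* f p) ≡ ∑[ v ← words k ] (w v ℕ.* f (packing v))
    x-to-w f = trans (A.split f) (trans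
      (cong (λ r → ∑[ v ← words k ] (w v ℕ.* f (packing v)) ℕ.+ r)
        (∑-zero (allSubsets n) (λ p → cong (ℕ._* f p) (nothing-left p))))
      (ℕ.+-identityʳ _))

    total-w : ∑ (allSubsets n) x ≡ W
    total-w = begin
      ∑ (allSubsets n) x                         ≡⟨ ∑-cong (allSubsets n) (λ p → sym (ℕ.*-identityʳ (x p))) ⟩
      ∑[ p ← allSubsets n ] (x p ℕ.* 1)          ≡⟨ x-to-w (λ _ → 1) ⟩
      ∑[ v ← words k ] (w v ℕ.* 1)               ≡⟨ ∑-cong (words k) (λ v → ℕ.*-identityʳ (w v)) ⟩
      W                                          ∎
      where open ≡-Reasoning

    items≤ : 3 ℕ.* M ℕ.≤ d ℕ.+ 3 ℕ.* W
    items≤ = begin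
      n                                                            ≤⟨ covers-below x D covers n ℕ.≤-refl ⟩
      d ℕ.+ ∑[ p ← allSubsets n ] (x p ℕ.* below n p)              ≡⟨ cong (d ℕ.+_) (x-to-w (below n)) ⟩
      d ℕ.+ ∑[ v ← words k ] (w v ℕ.* below n (packing v))        ≤⟨ ℕ.+-monoʳ-≤ d (∑-mono (words k) (λ v →
                                                                        ℕ.*-monoʳ-≤ (w v) (below≤3 n v))) ⟩
      d ℕ.+ ∑[ v ← words k ] (w v ℕ.* 3)                           ≡⟨ cong (d ℕ.+_) (trans (∑-*ʳ (words k) 3 w) (ℕ.*-comm W 3)) ⟩
      d ℕ.+ 3 ℕ.* W                                                ∎
      where open ℕ.≤-Reasoning

    -- Covering is applied to the items of the earlier groups together with the first `⌊ e /2⌋` of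
    -- group `t`. Doubling returns from items to positions; the added 1 accounts for an odd `e`.
    group≤ : ∀ t e → e ℕ.≤ 3 ℕ.^ k →
      2 ℕ.* (toℕ t ℕ.* M) ℕ.+ e ℕ.≤ 1 ℕ.+ 2 ℕ.* (d ℕ.+ (toℕ t ℕ.* W ℕ.+ pre k t e w))
    group≤ t e e≤N = begin
      2 ℕ.* (toℕ t ℕ.* M) ℕ.+ e                          ≤⟨ ℕ.+-monoʳ-≤ (2 ℕ.* (toℕ t ℕ.* M)) (≤1+2⌊n/2⌋ e) ⟩
      2 ℕ.* (toℕ t ℕ.* M) ℕ.+ (1 ℕ.+ 2 ℕ.* ⌊ e /2⌋)     ≡⟨ lemma (toℕ t ℕ.* M) ⌊ e /2⌋ ⟩
      1 ℕ.+ 2 ℕ.* m                                      ≤⟨ ℕ.+-monoʳ-≤ 1 (ℕ.*-monoʳ-≤ 2 m≤) ⟩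
      1 ℕ.+ 2 ℕ.* (d ℕ.+ (toℕ t ℕ.* W ℕ.+ pre k t e w))  ∎
      where
      open ℕ.≤-Reasoning
      m : ℕ
      m = toℕ t ℕ.* M ℕ.+ ⌊ e /2⌋

      lemma : ∀ a b → 2 ℕ.* a ℕ.+ (1 ℕ.+ 2 ℕ.* b) ≡ 1 ℕ.+ 2 ℕ.* (a ℕ.+ b)
      lemma = ℕ-Solver.solve-∀

      q≤M : ⌊ e /2⌋ ℕ.≤ M
      q≤M = begin
        ⌊ e /2⌋              ≤⟨ ℕ.⌊n/2⌋-mono (ℕ.≤-trans e≤N (ℕ.≤-reflexive (3^k≡1+2half k))) ⟩
        ⌊ 1 ℕ.+ 2 ℕ.* M /2⌋  ≡⟨ ⌊1+2*n/2⌋ M ⟩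
        M                    ∎

      m≤n : m ℕ.≤ n
      m≤n = begin
        toℕ t ℕ.* M ℕ.+ ⌊ e /2⌋  ≤⟨ ℕ.+-mono-≤ (ℕ.*-monoˡ-≤ M (Fin.toℕ≤pred[n] t)) q≤M ⟩
        2 ℕ.* M ℕ.+ M            ≡⟨ ℕ.+-comm (2 ℕ.* M) M ⟩
        3 ℕ.* M                  ∎

      m≤ : m ℕ.≤ d ℕ.+ (toℕ t ℕ.* W ℕ.+ pre k t e w)
      m≤ = begin
        m
          ≤⟨ covers-below x D covers m m≤n ⟩
        d ℕ.+ ∑[ p ← allSubsets n ] (x p ℕ.* below m p)
          ≡⟨ cong (d ℕ.+_) (x-to-w (below m)) ⟩
        d ℕ.+ ∑[ v ← words k ] (w v ℕ.* below m (packing v))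
          ≤⟨ ℕ.+-monoʳ-≤ d (∑-mono (words k) (λ v → ℕ.*-monoʳ-≤ (w v) (below-group t e v q≤M))) ⟩
        d ℕ.+ ∑[ v ← words k ] (w v ℕ.* (toℕ t ℕ.+ 𝟙 (pos t v ℕ.<? e)))
          ≡⟨ cong (d ℕ.+_) (∑-cong (words k) (λ v → distrib (w v) (toℕ t) (𝟙 (pos t v ℕ.<? e)))) ⟩
        d ℕ.+ ∑[ v ← words k ] (toℕ t ℕ.* w v ℕ.+ 𝟙 (pos t v ℕ.<? e) ℕ.* w v)
          ≡⟨ cong (d ℕ.+_) (∑-+ (words k) (λ v → toℕ t ℕ.* w v) (λ v → 𝟙 (pos t v ℕ.<? e) ℕ.* w v)) ⟩
        d ℕ.+ (∑[ v ← words k ] (toℕ t ℕ.* w v) ℕ.+ pre k t e w)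
          ≡⟨ cong (λ s → d ℕ.+ (s ℕ.+ pre k t e w)) (∑-*ˡ (words k) (toℕ t) w) ⟩
        d ℕ.+ (toℕ t ℕ.* W ℕ.+ pre k t e w) ∎
        where
        distrib : ∀ a b c → a ℕ.* (b ℕ.+ c) ≡ b ℕ.* a ℕ.+ c ℕ.* a
        distrib = ℕ-Solver.solve-∀

    -- The covering bounds, summed over the three orders, are played against the prefixes of small
    -- total from `low-prefixes`.
    rounding-bound : + 6 * + k ≤
      + 37 * (+ 6 * + ∑ (allSubsets n) x + + 4 * + d - + 3 * + (3 ℕ.^ k)) + + 150
    rounding-bound = subst₂ (λ X N → + 6 * + k ≤ + 37 * (+ 6 * X + + 4 * + d - + 3 * N) + + 150)
      (cong +_ (sym total-w))
      (trans (cong (λ m → + 1 + m) (sym (pos-* 2 M))) (cong +_ (sym (3^k≡1+2half k))))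
      (combine (+ k) (+ M) (+ P) (+ sum₃ e) (+ d) (+ W) bound
        (subst₂ _≤_ (cong (λ m → m + + sum₃ e) (pos-* 6 M))
          (cong₂ (λ a b → a + b + + 3) (cong₂ _+_ (pos-* 6 d) (pos-* 6 W)) (pos-* 2 P))
          (+≤+ prefixes))
        (subst₂ _≤_ (pos-* 3 M) (cong (λ s → + d + s) (pos-* 3 W)) (+≤+ items≤))
        (+≤+ z≤n))
      where
      open LowPrefixes (low-prefixes k w)
      P : ℕ
      P = sum₃ (λ t → pre k t (e t) w)

      prefixes : 6 ℕ.* M ℕ.+ sum₃ e ℕ.≤ 6 ℕ.* d ℕ.+ 6 ℕ.* W ℕ.+ 2 ℕ.* P ℕ.+ 3
      prefixes = begin
        6 ℕ.* M ℕ.+ sum₃ e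
          ≡⟨ lhs M (e 0F) (e 1F) (e 2F) ⟩
        sum₃ (λ t → 2 ℕ.* (toℕ t ℕ.* M) ℕ.+ e t)
          ≤⟨ ℕ.+-mono-≤ (ℕ.+-mono-≤ (group≤ 0F (e 0F) (e≤ 0F)) (group≤ 1F (e 1F) (e≤ 1F)))
               (group≤ 2F (e 2F) (e≤ 2F)) ⟩
        sum₃ (λ t → 1 ℕ.+ 2 ℕ.* (d ℕ.+ (toℕ t ℕ.* W ℕ.+ pre k t (e t) w)))
          ≡⟨ rhs d W (pre k 0F (e 0F) w) (pre k 1F (e 1F) w) (pre k 2F (e 2F) w) ⟩
        6 ℕ.* d ℕ.+ 6 ℕ.* W ℕ.+ 2 ℕ.* P ℕ.+ 3 ∎
        where
        open ℕ.≤-Reasoning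
        lhs : ∀ M x y z → 6 ℕ.* M ℕ.+ (x ℕ.+ y ℕ.+ z) ≡
          (2 ℕ.* (0 ℕ.* M) ℕ.+ x) ℕ.+ (2 ℕ.* (1 ℕ.* M) ℕ.+ y) ℕ.+ (2 ℕ.* (2 ℕ.* M) ℕ.+ z)
        lhs = ℕ-Solver.solve-∀
        rhs : ∀ d W x y z →
          (1 ℕ.+ 2 ℕ.* (d ℕ.+ (0 ℕ.* W ℕ.+ x))) ℕ.+ (1 ℕ.+ 2 ℕ.* (d ℕ.+ (1 ℕ.* W ℕ.+ y))) ℕ.+
          (1 ℕ.+ 2 ℕ.* (d ℕ.+ (2 ℕ.* W ℕ.+ z))) ≡
          6 ℕ.* d ℕ.+ 6 ℕ.* W ℕ.+ 2 ℕ.* (x ℕ.+ y ℕ.+ z) ℕ.+ 3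
        rhs = ℕ-Solver.solve-∀

open RoundingBound using (rounding-bound)

-- Embedding of the integers into the rationals, and estimates for constant reals and logarithms.

open import Data.Integer.Base using (+_)
open import Data.Rational.Base using (ℚ; 0ℚ; 1ℚ; ½; _/_; _+_; _-_; _*_; -_; _≤_; _<_; ∣_∣; toℚᵘ; NonNegative; *≤*)
open import Data.Rational.Properties

fromℤ-/1 : ∀ i → i / 1 ≡ fromℤ i
fromℤ-/1 i = ↥p/↧p≡p (fromℤ i)

fromℤ-+ : ∀ i j → fromℤ (i ℤ.+ j) ≡ fromℤ i + fromℤ j
fromℤ-+ i j = trans (sym (fromℤ-/1 (i ℤ.+ j)))
  (cong₂ (λ a b → (a ℤ.+ b) / 1) (sym (ℤ.*-identityʳ i)) (sym (ℤ.*-identityʳ j)))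

fromℤ-* : ∀ i j → fromℤ (i ℤ.* j) ≡ fromℤ i * fromℤ j
fromℤ-* i j = sym (fromℤ-/1 (i ℤ.* j))

fromℤ-neg : ∀ i → fromℤ (ℤ.- i) ≡ - fromℤ i
fromℤ-neg i = begin
  fromℤ (ℤ.- i)                      ≡⟨ lemma (fromℤ (ℤ.- i)) (fromℤ i) ⟩
  fromℤ i + fromℤ (ℤ.- i) - fromℤ i  ≡⟨ cong (_- fromℤ i) (sym (fromℤ-+ i (ℤ.- i))) ⟩
  fromℤ (i ℤ.- i) - fromℤ i          ≡⟨ cong (λ z → fromℤ z - fromℤ i) (ℤ.+-inverseʳ i) ⟩
  0ℚ - fromℤ i                       ≡⟨ +-identityˡ (- fromℤ i) ⟩
  - fromℤ i                          ∎
  where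
  open ≡-Reasoning
  open +-*-Solver using (solve; _:=_; _:+_; _:-_)
  lemma : ∀ a b → a ≡ b + a - b
  lemma = solve 2 (λ a b → a := b :+ a :- b) refl

fromℤ-mono : ∀ {i j} → i ℤ.≤ j → fromℤ i ≤ fromℤ j
fromℤ-mono {i} {j} i≤j = *≤* (subst₂ ℤ._≤_ (sym (ℤ.*-identityʳ i)) (sym (ℤ.*-identityʳ j)) i≤j)

fromℤ-cancel : ∀ {i j} → fromℤ i ≤ fromℤ j → i ℤ.≤ j
fromℤ-cancel {i} {j} i≤j = subst₂ ℤ._≤_ (ℤ.*-identityʳ i) (ℤ.*-identityʳ j) (drop-*≤* i≤j)

ι : ℕ → ℚ
ι n = fromℤ (+ n)

/≤ι : ∀ u a v → u ℕ.≤ v ℕ.* suc a → + u / suc a ≤ ι v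
/≤ι u a v u≤ = toℚᵘ-cancel-≤ (begin
  toℚᵘ (+ u / suc a)   ≃⟨ toℚᵘ-fromℚᵘ (ℚᵘ.mkℚᵘ (+ u) a) ⟩
  ℚᵘ.mkℚᵘ (+ u) a      ≤⟨ ℚᵘ.*≤* (subst₂ ℤ._≤_ (sym (ℤ.*-identityʳ (+ u))) (ℤ.pos-* v (suc a)) (ℤ.+≤+ u≤)) ⟩
  toℚᵘ (ι v)           ∎)
  where open ℚᵘ.≤-Reasoning

⅓ : ℚ
⅓ = + 1 / 3

-- The logarithm is monotone and exact on powers of 2, so the bound holds for every term of the
-- Cauchy sequence and not only for its limit.
log-seq≤ : ∀ n b → n ℕ.≤ 2 ℕ.^ b → ∀ j → ∣ log-seq n j ∣ ≤ ι b
log-seq≤ n b n≤ j = subst (_≤ ι b) (sym (0≤p⇒∣p∣≡p 0≤))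
  (/≤ι ⌊log₂ (n ℕ.^ suc j) ⌋ j b (begin
    ⌊log₂ (n ℕ.^ suc j) ⌋          ≤⟨ ⌊log₂⌋-mono-≤ (ℕ.^-monoˡ-≤ (suc j) n≤) ⟩
    ⌊log₂ ((2 ℕ.^ b) ℕ.^ suc j) ⌋  ≡⟨ cong ⌊log₂_⌋ (ℕ.^-*-assoc 2 b (suc j)) ⟩
    ⌊log₂ (2 ℕ.^ (b ℕ.* suc j)) ⌋  ≡⟨ ⌊log₂[2^n]⌋≡n (b ℕ.* suc j) ⟩
    b ℕ.* suc j                    ∎))
  where
  open ℕ.≤-Reasoning
  0≤ : 0ℚ ≤ log-seq n j
  0≤ = nonNegative⁻¹ (log-seq n j) {{normalize-nonNeg ⌊log₂ (n ℕ.^ suc j) ⌋ (suc j)}}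

fromℚ-mono : ∀ {p q} → p ≤ q → fromℚ p R.≤ fromℚ q
fromℚ-mono {p} {q} p≤q ε 0<ε = 0 , λ _ _ →
  ≤-trans p≤q (≤-trans (≤-reflexive (sym (+-identityʳ q))) (+-monoʳ-≤ q (<⇒≤ 0<ε)))

fromℚ-strict : ∀ {p q} ε → 0ℚ < ε → p + ε ≤ q → fromℚ p R.< fromℚ q
fromℚ-strict ε 0<ε le = ε , 0<ε , 0 , λ _ _ → le

-- The sizes and the fractional values are natural multiples of a fixed `q`, so their real sums
-- reduce to counting at every index `j`.
Σℝ-fromℚ : ∀ {A : Set} (xs : List A) (c : A → ℕ) q j →
  seq (Σℝ (map (λ a → fromℚ (ι (c a) * q)) xs)) j ≡ ι (∑ xs c) * q
Σℝ-fromℚ []       c q j = sym (*-zeroˡ q)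
Σℝ-fromℚ (x ∷ xs) c q j = begin
  ι (c x) * q + seq (Σℝ (map (λ a → fromℚ (ι (c a) * q)) xs)) j  ≡⟨ cong (_+_ (ι (c x) * q)) (Σℝ-fromℚ xs c q j) ⟩
  ι (c x) * q + ι (∑ xs c) * q                                   ≡⟨ sym (*-distribʳ-+ q (ι (c x)) (ι (∑ xs c))) ⟩
  (ι (c x) + ι (∑ xs c)) * q                                     ≡⟨ cong (_* q) (sym (fromℤ-+ (+ c x) (+ ∑ xs c))) ⟩
  ι (c x ℕ.+ ∑ xs c) * q                                         ∎
  where open ≡-Reasoning

ι*-mono : ∀ {a b} q .{{_ : NonNegative q}} → a ℕ.≤ b → ι a * q ≤ ι b * q
ι*-mono q a≤b = *-monoʳ-≤-nonNeg q (fromℤ-mono (ℤ.+≤+ a≤b))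

-- The hard instance and the lower bound on its real gap.

module _ (k : ℕ) where

  private
    n : ℕ
    n = items k

  thirds : Sizes n
  thirds _ = fromℚ (ι 1 * ⅓)

  halves : Subset n → ℝ
  halves p = fromℚ (ι (double-y {k} p) * ½)

  seq-total : ∀ p j → seq (total thirds p) j ≡ ι (size p) * ⅓
  seq-total p j = trans (Σℝ-fromℚ (filter (_∈? p) (allFin n)) (λ _ → 1) ⅓ j)
    (cong (λ c → ι c * ⅓) (∑-one (filter (_∈? p) (allFin n))))

  pattern-feasible : ∀ v → Feasible thirds (packing {k} v)
  pattern-feasible v ε 0<ε = 0 , λ j _ → begin
    seq (total thirds (packing {k} v)) j  ≡⟨ seq-total (packing {k} v) j ⟩
    ι (size (packing {k} v)) * ⅓          ≤⟨ ι*-mono ⅓ (size-pattern {k} v) ⟩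
    1ℚ                                     ≡⟨ sym (+-identityʳ 1ℚ) ⟩
    1ℚ + 0ℚ                                ≤⟨ +-monoʳ-≤ 1ℚ (<⇒≤ 0<ε) ⟩
    1ℚ + ε                                 ∎
    where open ≤-Reasoning

  halves-zero : ∀ p → multiplicity {k} p ≡ 0 → halves p ≃ 0ℝ
  halves-zero p eq = fromℚ-mono (≤-reflexive eq′) , fromℚ-mono (≤-reflexive (sym eq′))
    where
    eq′ : ι (double-y {k} p) * ½ ≡ 0ℚ
    eq′ = cong (λ m → ι (2 ℕ.⊓ m) * ½) eq

  hard-instance : Instance n
  hard-instance = record
    { s            = thirds
    ; isSizes      = record
      { nonneg = λ _ → fromℚ-mono (from-yes (0ℚ ≤? ι 1 * ⅓))
      ; ≤one   = λ _ → fromℚ-mono (from-yes (ι 1 * ⅓ ≤? 1ℚ))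
      ; sorted = λ _ _ _ → fromℚ-mono (≤-refl {ι 1 * ⅓})
      }
    ; y            = halves
    ; isFractional = record
      { nonneg = λ p → fromℚ-mono (ι*-mono ½ (z≤n {double-y {k} p}))
      ; ≤one   = λ p → fromℚ-mono (ι*-mono ½ (ℕ.m⊓n≤m 2 (multiplicity {k} p)))
      ; vanish = vanish
      ; covers = λ i ε 0<ε → 0 , λ j _ → begin
          1ℚ                                         ≤⟨ ι*-mono ½ (double-y-covers {k} i) ⟩
          ι (∑ (containing i) (double-y {k})) * ½     ≡⟨ sym (Σℝ-fromℚ (containing i) (double-y {k}) ½ j) ⟩
          seq (Σℝ (map halves (containing i))) j      ≡⟨ sym (+-identityʳ _) ⟩
          seq (Σℝ (map halves (containing i))) j + 0ℚ ≤⟨ +-monoʳ-≤ (seq (Σℝ (map halves (containing i))) j) (<⇒≤ 0<ε) ⟩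
          seq (Σℝ (map halves (containing i))) j + ε  ∎
      }
    }
    where
    open ≤-Reasoning
    vanish : ∀ p → ¬ Feasible thirds p → halves p ≃ 0ℝ
    vanish p infeasible with multiplicity {k} p ℕ.≟ 0
    ... | yes eq = halves-zero p eq
    ... | no ≢0 with multiplicity-nonzero {k} p ≢0
    ...   | v , refl = ⊥-elim (infeasible (pattern-feasible v))

  module _ (ρ : Rounding hard-instance) where
    open Rounding ρ

    private
      X d C : ℕ
      X = ∑ (allSubsets n) x
      d = size D
      C = ∑ (allSubsets n) (double-y {k})

    -- Feasibility cannot be decided, so the support condition is used to refute it when `x p` is
    -- nonzero; then `vanish` applies.
    supported : ∀ p → multiplicity {k} p ≡ 0 → x p ≡ 0
    supported p eq with x p ℕ.≟ 0
    ... | yes xp≡0 = xp≡0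
    ... | no  xp≢0 = vanish p (λ feasible →
      proj₂ (support (feasible , xp≢0)) (halves-zero p eq))

    -- The factor is 222 = 37 · 6, where 6 clears the denominators of 1/3 and 1/2, and 37 is the
    -- factor in `rounding-bound`.
    scaled-gap : ∀ j → fromℤ (+ 222) * seq (gap hard-instance ρ) j ≡
      fromℤ (+ 37 ℤ.* (+ 6 ℤ.* + X ℤ.+ + 4 ℤ.* + d ℤ.- + 3 ℤ.* + C))
    scaled-gap j = begin
      fromℤ (+ 222) * (+ X / 1 + fromℤ (+ 2) * seq (total thirds D) j - seq (Σℝ (map halves (allSubsets n))) j)
        ≡⟨ cong₂ (λ a b → fromℤ (+ 222) * (a - b))
             (cong₂ (λ a b → a + fromℤ (+ 2) * b) (fromℤ-/1 (+ X)) (seq-total D j))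
             (Σℝ-fromℚ (allSubsets n) (double-y {k}) ½ j) ⟩
      fromℤ (+ 222) * (ι X + fromℤ (+ 2) * (ι d * ⅓) - ι C * ½)
        ≡⟨ lemma (ι X) (ι d) (ι C) ⟩
      fromℤ (+ 37) * (fromℤ (+ 6) * ι X + fromℤ (+ 4) * ι d - fromℤ (+ 3) * ι C)
        ≡⟨ sym (homomorphic (+ X) (+ d) (+ C)) ⟩
      fromℤ (+ 37 ℤ.* (+ 6 ℤ.* + X ℤ.+ + 4 ℤ.* + d ℤ.- + 3 ℤ.* + C)) ∎
      where
      open ≡-Reasoning
      open +-*-Solver using (solve; _:=_; _:+_; _:-_; _:*_; con)
      lemma : ∀ x d c → fromℤ (+ 222) * (x + fromℤ (+ 2) * (d * ⅓) - c * ½) ≡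
        fromℤ (+ 37) * (fromℤ (+ 6) * x + fromℤ (+ 4) * d - fromℤ (+ 3) * c)
      lemma = solve 3 (λ x d c →
        con (fromℤ (+ 222)) :* (x :+ con (fromℤ (+ 2)) :* (d :* con ⅓) :- c :* con ½) :=
        con (fromℤ (+ 37)) :* (con (fromℤ (+ 6)) :* x :+ con (fromℤ (+ 4)) :* d :- con (fromℤ (+ 3)) :* c)) refl

      homomorphic : ∀ x d c → fromℤ (+ 37 ℤ.* (+ 6 ℤ.* x ℤ.+ + 4 ℤ.* d ℤ.- + 3 ℤ.* c)) ≡
        fromℤ (+ 37) * (fromℤ (+ 6) * fromℤ x + fromℤ (+ 4) * fromℤ d - fromℤ (+ 3) * fromℤ c)
      homomorphic x d c = trans (fromℤ-* (+ 37) (+ 6 ℤ.* x ℤ.+ + 4 ℤ.* d ℤ.- + 3 ℤ.* c))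
        (cong (_*_ (fromℤ (+ 37)))
        (trans (fromℤ-+ (+ 6 ℤ.* x ℤ.+ + 4 ℤ.* d) (ℤ.- (+ 3 ℤ.* c)))
        (cong₂ _+_
          (trans (fromℤ-+ (+ 6 ℤ.* x) (+ 4 ℤ.* d)) (cong₂ _+_ (fromℤ-* (+ 6) x) (fromℤ-* (+ 4) d)))
          (trans (fromℤ-neg (+ 3 ℤ.* c)) (cong -_ (fromℤ-* (+ 3) c))))))

    gap-lower-bound : ∀ j → ι (6 ℕ.* k) ≤ fromℤ (+ 222) * seq (gap hard-instance ρ) j + ι 150
    gap-lower-bound j = begin
      ι (6 ℕ.* k)
        ≡⟨ cong fromℤ (ℤ.pos-* 6 k) ⟩
      fromℤ (+ 6 ℤ.* + k)
        ≤⟨ fromℤ-mono (rounding-bound {k} x D supported covers) ⟩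
      fromℤ (+ 37 ℤ.* (+ 6 ℤ.* + X ℤ.+ + 4 ℤ.* + d ℤ.- + 3 ℤ.* + (3 ℕ.^ k)) ℤ.+ + 150)
        -- Truncation may push the fractional value below 3^k / 2, which can only enlarge the gap.
        ≤⟨ fromℤ-mono (ℤ.+-monoˡ-≤ (+ 150) (ℤ.*-monoˡ-≤-nonNeg (+ 37) (ℤ.+-monoʳ-≤ (+ 6 ℤ.* + X ℤ.+ + 4 ℤ.* + d)
             (ℤ.neg-mono-≤ (ℤ.*-monoˡ-≤-nonNeg (+ 3) (ℤ.+≤+ (double-y-total {k}))))))) ⟩
      fromℤ (+ 37 ℤ.* (+ 6 ℤ.* + X ℤ.+ + 4 ℤ.* + d ℤ.- + 3 ℤ.* + C) ℤ.+ + 150)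
        ≡⟨ fromℤ-+ (+ 37 ℤ.* (+ 6 ℤ.* + X ℤ.+ + 4 ℤ.* + d ℤ.- + 3 ℤ.* + C)) (+ 150) ⟩
      fromℤ (+ 37 ℤ.* (+ 6 ℤ.* + X ℤ.+ + 4 ℤ.* + d ℤ.- + 3 ℤ.* + C)) + ι 150
        ≡⟨ cong (_+ ι 150) (sym (scaled-gap j)) ⟩
      fromℤ (+ 222) * seq (gap hard-instance ρ) j + ι 150 ∎
      where open ≤-Reasoning

-- Comparison of the linear gap with the logarithm of the number of items.

half≤3^k : ∀ k → half k ℕ.≤ 3 ℕ.^ k
half≤3^k k = ℕ.≤-trans (ℕ.≤-trans (ℕ.m≤m+n (half k) _) (ℕ.n≤1+n _)) (ℕ.≤-reflexive (sym (3^k≡1+2half k)))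

k≤half : ∀ k → k ℕ.≤ half k
k≤half zero    = z≤n
k≤half (suc k) = s≤s (ℕ.≤-trans (k≤half k) (ℕ.m≤m+n (half k) _))

k≤items : ∀ k → k ℕ.≤ items k
k≤items k = ℕ.≤-trans (k≤half k) (ℕ.m≤m+n (half k) _)

items≤2^ : ∀ k → items k ℕ.≤ 2 ℕ.^ (2 ℕ.* suc k)
items≤2^ k = begin
  3 ℕ.* half k            ≤⟨ ℕ.*-monoʳ-≤ 3 (half≤3^k k) ⟩
  3 ℕ.^ suc k             ≤⟨ ℕ.^-monoˡ-≤ (suc k) (ℕ.n≤1+n 3) ⟩
  (2 ℕ.^ 2) ℕ.^ suc k     ≡⟨ ℕ.^-*-assoc 2 2 (suc k) ⟩
  2 ℕ.^ (2 ℕ.* suc k)     ∎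
  where open ℕ.≤-Reasoning

p≤∣p∣ : ∀ p → p ≤ ∣ p ∣
p≤∣p∣ p with ≤-total 0ℚ p
... | inj₁ 0≤p = ≤-reflexive (sym (0≤p⇒∣p∣≡p 0≤p))
... | inj₂ p≤0 = ≤-trans p≤0 (0≤∣p∣ p)

-- The gap is at least (6 k − 150) / 222, while log₂ (items k) ≤ 2 (k + 1); thus
-- ε₀ log₂ (items k) grows in k with half the slope of the gap.
ε₀ : ℚ
ε₀ = + 1 / 148

no-small-gap : ∀ k → 200 ℕ.≤ k → (ρ : Rounding (hard-instance k)) (g : ℝ) →
  gap (hard-instance k) ρ R.≤ g → ¬ (R.∣ g ∣ R.≤ fromℚ ε₀ R.* R.∣ log₂ (items k) ∣)
no-small-gap k 200≤k ρ g gap≤ g≤ = ℕ.<⇒≱ large (ℤ.drop‿+≤+ (fromℤ-cancel bound))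
  where
  n : ℕ
  n = items k

  0<1 : 0ℚ < 1ℚ
  0<1 = from-yes (0ℚ <? 1ℚ)

  -- From this index on, both real inequalities hold for the approximations up to an error of 1.
  j : ℕ
  j = proj₁ (gap≤ 1ℚ 0<1) ℕ.⊔ proj₁ (g≤ 1ℚ 0<1)

  -- The slope is 3 = 222 · 2 / 148, and 594 = 150 + 222 · 2 includes the two errors of 1. The
  -- inequality amounts to 3 k > 597, that is, to `200 ≤ k`.
  large : 3 ℕ.* suc k ℕ.+ 594 ℕ.< 6 ℕ.* k
  large = begin-strict
    3 ℕ.* suc k ℕ.+ 594   ≡⟨ lhs k ⟩
    3 ℕ.* k ℕ.+ 597       <⟨ ℕ.+-monoʳ-< (3 ℕ.* k) (ℕ.<-≤-trans (from-yes (597 ℕ.<? 3 ℕ.* 200)) (ℕ.*-monoʳ-≤ 3 200≤k)) ⟩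
    3 ℕ.* k ℕ.+ 3 ℕ.* k   ≡⟨ sym (ℕ.*-distribʳ-+ k 3 3) ⟩
    6 ℕ.* k               ∎
    where
    open ℕ.≤-Reasoning
    lhs : ∀ k → 3 ℕ.* suc k ℕ.+ 594 ≡ 3 ℕ.* k ℕ.+ 597
    lhs k = trans (cong (ℕ._+ 594) (trans (ℕ.*-suc 3 k) (ℕ.+-comm 3 (3 ℕ.* k)))) (ℕ.+-assoc (3 ℕ.* k) 3 594)

  bound : ι (6 ℕ.* k) ≤ ι (3 ℕ.* suc k ℕ.+ 594)
  bound = begin
    ι (6 ℕ.* k)
      ≤⟨ gap-lower-bound k ρ j ⟩
    fromℤ (+ 222) * seq (gap (hard-instance k) ρ) j + ι 150
      ≤⟨ +-monoˡ-≤ (ι 150) (*-monoˡ-≤-nonNeg (fromℤ (+ 222)) gap-seq≤) ⟩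
    fromℤ (+ 222) * (ε₀ * ι (2 ℕ.* suc k) + 1ℚ + 1ℚ) + ι 150
      ≡⟨ cong (λ z → fromℤ (+ 222) * (ε₀ * z + 1ℚ + 1ℚ) + ι 150)
           (trans (cong fromℤ (ℤ.pos-* 2 (suc k))) (fromℤ-* (+ 2) (+ suc k))) ⟩
    fromℤ (+ 222) * (ε₀ * (fromℤ (+ 2) * ι (suc k)) + 1ℚ + 1ℚ) + ι 150
      ≡⟨ eq (ι (suc k)) ⟩
    fromℤ (+ 3) * ι (suc k) + ι 594
      ≡⟨ cong (_+ ι 594) (trans (sym (fromℤ-* (+ 3) (+ suc k))) (cong fromℤ (sym (ℤ.pos-* 3 (suc k))))) ⟩
    ι (3 ℕ.* suc k) + ι 594
      ≡⟨ sym (fromℤ-+ (+ (3 ℕ.* suc k)) (+ 594)) ⟩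
    ι (3 ℕ.* suc k ℕ.+ 594) ∎
    where
    open ≤-Reasoning
    open +-*-Solver using (solve; _:=_; _:+_; _:*_; con)
    eq : ∀ x → fromℤ (+ 222) * (ε₀ * (fromℤ (+ 2) * x) + 1ℚ + 1ℚ) + ι 150 ≡ fromℤ (+ 3) * x + ι 594
    eq = solve 1 (λ x → con (fromℤ (+ 222)) :* (con ε₀ :* (con (fromℤ (+ 2)) :* x) :+ con 1ℚ :+ con 1ℚ) :+ con (ι 150) :=
      con (fromℤ (+ 3)) :* x :+ con (ι 594)) refl

    gap-seq≤ : seq (gap (hard-instance k) ρ) j ≤ ε₀ * ι (2 ℕ.* suc k) + 1ℚ + 1ℚ
    gap-seq≤ = begin
      seq (gap (hard-instance k) ρ) j
        ≤⟨ proj₂ (gap≤ 1ℚ 0<1) j (ℕ.m≤m⊔n _ _) ⟩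
      seq g j + 1ℚ
        ≤⟨ +-monoˡ-≤ 1ℚ (p≤∣p∣ (seq g j)) ⟩
      ∣ seq g j ∣ + 1ℚ
        ≤⟨ +-monoˡ-≤ 1ℚ (proj₂ (g≤ 1ℚ 0<1) j (ℕ.m≤n⊔m (proj₁ (gap≤ 1ℚ 0<1)) _)) ⟩
      ε₀ * ∣ log-seq n j ∣ + 1ℚ + 1ℚ
        ≤⟨ +-monoˡ-≤ 1ℚ (+-monoˡ-≤ 1ℚ (*-monoˡ-≤-nonNeg ε₀ (log-seq≤ n (2 ℕ.* suc k) (items≤2^ k) j))) ⟩
      ε₀ * ι (2 ℕ.* suc k) + 1ℚ + 1ℚ ∎

theorem11 : ¬ (Σ[ A ∈ RoundingUpAlgorithm ] Σ[ g ∈ (ℕ → ℝ) ] (g ∈o[ log₂ ] × AchievesGap A g))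
theorem11 (A , g , g∈o , achieves) = no-small-gap k (ℕ.m≤n⊔m N 200) (A (hard-instance k)) (g (items k))
  -- The margin 1/12 is 1/3 - 1/4.
  (achieves (hard-instance k) (λ _ → fromℚ-strict (+ 1 / 12) (from-yes (0ℚ <? + 1 / 12))
    (from-yes (+ 1 / 4 + + 1 / 12 ≤? ι 1 * ⅓))))
  (proj₂ small (items k) (ℕ.≤-trans (ℕ.m≤m⊔n N 200) (k≤items k)))
  where
  small : ∃[ N ] (∀ n → N ℕ.≤ n → R.∣ g n ∣ R.≤ fromℚ ε₀ R.* R.∣ log₂ n ∣)
  small = g∈o (fromℚ ε₀) (fromℚ-strict ε₀ (from-yes (0ℚ <? ε₀)) (≤-reflexive (+-identityˡ ε₀)))

  N k : ℕ
  N = proj₁ small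
  k = N ℕ.⊔ 200
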